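{- Let $n\ge 0$, let $X\subseteq\{0,1\}^n$ be nonempty, and let $G=Q_n(X)$ be the daisy cube generated by $X$. Then, as polynomials in $x,y$, $$D_{G,0^n}(x,y)=C_G(x+y-1),$$ where $D_{G,0^n}$ is the distance cube polynomial of $G$ with respect to the vertex $0^n$ and $C_G$ is the cube polynomial of $G$.
   Context: The $n$-cube $Q_n$ is the graph with vertex set $\{0,1\}^n$, two words being adjacent if they differ in exactly one coordinate ($Q_0=K_1$). $0^n$ is the all-zero word. For $u,v\in\{0,1\}^n$ write $u\le v$ if $u_i\le v_i$ for all $i$. For $X\subseteq\{0,1\}^n$, the daisy cube $Q_n(X)$ generated by $X$ is the subgraph of $Q_n$ induced by $\{u\in\{0,1\}^n : u\le x \text{ for some } x\in X\}$. For a finite graph $G$, $c_k(G)$ ($k\ge0$) is the number of induced subgraphs of $G$ isomorphic to $Q_k$, and the cube polynomial is $C_G(x)=\sum_{k\ge 0}c_k(G)x^k$. For $u\in V(G)$ and a subgraph $H$ of $G$, $d(u,H)=\min_{v\in V(H)}d_G(u,v)$. Let $c_{k,d}(G)$ ($k,d\ge 0$) be the number of induced subgraphs $H$ of $G$ isomorphic to $Q_k$ with $d(u,H)=d$. The distance cube polynomial of $G$ with respect to $u$ is $D_{G,u}(x,y)=\sum_{k,d\ge0}c_{k,d}(G)x^ky^d$. -}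

module Defs where

open import Algebra.Bundles.Raw using (RawRing)
open import Data.Bool.Base as Bool using (Bool; true; false; T)
import Data.Bool.Properties as Bool
open import Data.Fin.Base using (Fin; zero; suc; finToFun; funToFin)
open import Data.Fin.Properties
  using (any?; all?; finToFun-funToFin; 0↔⊥; 1↔⊤; 2↔Bool; +↔⊎; *↔×)
import Data.Fin.Properties as Fin
open import Data.Fin.Subset using (Subset; _∈_)
open import Data.Fin.Subset.Properties using (_∈?_)
open import Data.Integer.Base using (ℤ; +_; +-*-rawRing)
open import Data.List.Base as List using (List; []; _∷_; length; filter; upTo)
open import Data.Nat.Base using (ℕ; zero; suc; _≤_; _^_)
open import Data.Nat.Properties using (≮⇒≥; <⇒≱; allUpTo?)
open import Data.Product.Base using (Σ; ∃; _×_; _,_; proj₁; proj₂)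
open import Data.Product using (∃!)
open import Data.Product.Function.NonDependent.Propositional using (_×-↔_)
open import Data.Sum.Base using (_⊎_; inj₁; inj₂)
open import Data.Sum.Function.Propositional using (_⊎-↔_)
open import Data.Vec.Base using (Vec; []; _∷_; lookup; replicate)
open import Data.Vec.Relation.Binary.Pointwise.Inductive as Pointwise
  using (Pointwise; []; _∷_)
open import Function.Base using (_∘_; _on_)
open import Function.Bundles using (_↔_; _⇔_; Inverse; Equivalence; mk↔ₛ′; mk⇔)
open import Function.Properties.Inverse using (↔-sym; ↔-trans; ↔⇒↣)
open import Level using (Level; 0ℓ)
open import Relation.Binary.Core using (Rel)
open import Relation.Binary.Definitions as Binary
  using (DecidableEquality; Symmetric; Irreflexive)
open import Relation.Binary.PropositionalEquality
  using (_≡_; _≢_; _≗_; refl; sym; trans; cong; subst; subst₂)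
open import Relation.Nullary.Decidable
  using (Dec; yes; no; True; fromWitness; map′; _×-dec_; _→-dec_; ¬?; via-injection)
open import Relation.Nullary.Negation using (contradiction)
open import Relation.Unary using (Pred; Decidable; Satisfiable)

private
  variable
    ℓ : Level
    A B : Set
    n : ℕ

------------------------------------------------------------------------
-- Finite types

record Finite (A : Set) : Set where
  field
    size : ℕ
    enum : A ↔ Fin size

  open Inverse enum public
    using () renaming (to to index; from to element;
                       strictlyInverseˡ to index-element;
                       strictlyInverseʳ to element-index)

  elements : List A
  elements = List.tabulate element

  _≟_ : DecidableEquality A
  _≟_ = via-injection (↔⇒↣ enum) Fin._≟_

  ∃? : {P : Pred A ℓ} → Decidable P → Dec (∃ P)
  ∃? {P = P} P? = map′
    (λ (i , p) → element i , p)
    (λ (x , p) → index x , subst P (sym (element-index x)) p)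
    (any? (P? ∘ element))

  ∀? : {P : Pred A ℓ} → Decidable P → Dec (∀ x → P x)
  ∀? {P = P} P? = map′
    (λ h x → subst P (element-index x) (h (index x)))
    (λ h i → h (element i))
    (all? (P? ∘ element))

  count : {P : Pred A ℓ} → Decidable P → ℕ
  count P? = length (filter P? elements)

-- Without function extensionality, A → B is only finite up to _≗_, so
-- searching it requires the predicate to respect _≗_.
∃-function? : Finite A → Finite B → {P : Pred (A → B) ℓ} →
              (∀ {f g} → f ≗ g → P f → P g) → Decidable P → Dec (∃ P)
∃-function? {A} {B} finA finB resp P? = map′
  (λ (c , p) → decode c , p)
  (λ (f , p) → encode f , resp (λ x → sym (decode-encode f x)) p)
  (any? (P? ∘ decode))
  where
  module A = Finite finA
  module B = Finite finB

  decode : Fin (B.size ^ A.size) → A → B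
  decode c x = B.element (finToFun c (A.index x))

  encode : (A → B) → Fin (B.size ^ A.size)
  encode f = funToFin (B.index ∘ f ∘ A.element)

  decode-encode : ∀ f → decode (encode f) ≗ f
  decode-encode f x = trans
    (cong B.element (finToFun-funToFin (B.index ∘ f ∘ A.element) (A.index x)))
    (trans (B.element-index _) (cong f (A.element-index x)))

Σ-T-≡ : {b : A → Bool} {p q : Σ A (T ∘ b)} → proj₁ p ≡ proj₁ q → p ≡ q
Σ-T-≡ refl = cong (_ ,_) (Bool.T-irrelevant _ _)

T-finite : ∀ b → Finite (T b)
T-finite true  = record { enum = ↔-sym 1↔⊤ }
T-finite false = record { enum = ↔-sym 0↔⊥ }

Σ-Fin-finite : ∀ {m} (b : Fin m → Bool) → Finite (Σ (Fin m) (T ∘ b))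
Σ-Fin-finite {zero}  b = record
  { size = 0 ; enum = mk↔ₛ′ (λ ()) (λ ()) (λ ()) (λ ()) }
Σ-Fin-finite {suc m} b = record
  { enum = ↔-trans split (↔-trans (Z.enum ⊎-↔ S.enum) (↔-sym +↔⊎)) }
  where
  module Z = Finite (T-finite (b zero))
  module S = Finite (Σ-Fin-finite (b ∘ suc))

  split : Σ (Fin (suc m)) (T ∘ b) ↔ (T (b zero) ⊎ Σ (Fin m) (T ∘ b ∘ suc))
  split = mk↔ₛ′
    (λ { (zero , p) → inj₁ p ; (suc i , p) → inj₂ (i , p) })
    (λ { (inj₁ p) → zero , p ; (inj₂ (i , p)) → suc i , p })
    (λ { (inj₁ p) → refl ; (inj₂ (i , p)) → refl })
    (λ { (zero , p) → refl ; (suc i , p) → refl })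

Σ-finite : Finite A → (b : A → Bool) → Finite (Σ A (T ∘ b))
Σ-finite {A} finA b = record { enum = ↔-trans reindex F.enum }
  where
  open Finite finA
  module F = Finite (Σ-Fin-finite (b ∘ element))

  reindex : Σ A (T ∘ b) ↔ Σ (Fin size) (T ∘ b ∘ element)
  reindex = mk↔ₛ′
    (λ (x , p) → index x , subst (T ∘ b) (sym (element-index x)) p)
    (λ (i , p) → element i , p)
    (λ (i , p) → Σ-T-≡ (index-element i))
    (λ (x , p) → Σ-T-≡ (element-index x))

Vec-Bool-finite : ∀ n → Finite (Vec Bool n)
Vec-Bool-finite n = record { enum = go n }
  where
  uncons : ∀ {m} → Vec Bool (suc m) ↔ (Bool × Vec Bool m)
  uncons = mk↔ₛ′ (λ { (b ∷ v) → b , v }) (λ (b , v) → b ∷ v)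
    (λ _ → refl) (λ { (_ ∷ _) → refl })

  go : ∀ n → Vec Bool n ↔ Fin (2 ^ n)
  go zero    = mk↔ₛ′ (λ _ → zero) (λ _ → []) (λ { zero → refl }) (λ { [] → refl })
  go (suc n) = ↔-trans uncons (↔-trans (↔-sym 2↔Bool ×-↔ go n) (↔-sym *↔×))

------------------------------------------------------------------------
-- Finite simple graphs

record Graph : Set₁ where
  infix 4 _~_ _~?_
  field
    Vertex   : Set
    finite   : Finite Vertex
    _~_      : Rel Vertex 0ℓ
    _~?_     : Binary.Decidable _~_
    ~-sym    : Symmetric _~_
    ~-irrefl : Irreflexive _≡_ _~_

  open Finite finite public

open Graph using (Vertex; size)

-- `True` makes membership proofs unique, so that vertices of the induced
-- subgraph are equal exactly when they are equal in G.
induced : (G : Graph) {P : Pred (Vertex G) ℓ} → Decidable P → Graph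
induced G P? = record
  { Vertex   = Σ G.Vertex (λ v → True (P? v))
  ; finite   = Σ-finite G.finite _
  ; _~_      = G._~_ on proj₁
  ; _~?_     = λ u v → proj₁ u G.~? proj₁ v
  ; ~-sym    = G.~-sym
  ; ~-irrefl = λ { refl → G.~-irrefl refl }
  }
  where module G = Graph G

infix 4 _≅_ _≅?_

record _≅_ (G H : Graph) : Set where
  private
    module G = Graph G
    module H = Graph H
  field
    bijection : Vertex G ↔ Vertex H
  open Inverse bijection public using (to; from)
  field
    adjacency : ∀ u v → (u G.~ v) ⇔ (to u H.~ to v)

_≅?_ : (G H : Graph) → Dec (G ≅ H)
G ≅? H = map′
  (λ (f , g , fg , gf , adj) → record
    { bijection = mk↔ₛ′ f g fg gf
    ; adjacency = λ u v → mk⇔ (proj₁ (adj u v)) (proj₂ (adj u v)) })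
  (λ iso → let open _≅_ iso in
    to , from ,
    Inverse.strictlyInverseˡ bijection , Inverse.strictlyInverseʳ bijection ,
    λ u v → Equivalence.to (adjacency u v) , Equivalence.from (adjacency u v))
  (∃-function? G.finite H.finite
    (λ f≗f′ (g , p) → g , resp f≗f′ (λ _ → refl) p)
    (λ f → ∃-function? H.finite G.finite (resp (λ _ → refl)) (isIso? f)))
  where
  module G = Graph G
  module H = Graph H

  IsIso : (Vertex G → Vertex H) → (Vertex H → Vertex G) → Set
  IsIso f g = (∀ y → f (g y) ≡ y) × (∀ x → g (f x) ≡ x) ×
    (∀ u v → (u G.~ v → f u H.~ f v) × (f u H.~ f v → u G.~ v))

  isIso? : ∀ f → Decidable (IsIso f)
  isIso? f g =
    H.∀? (λ y → f (g y) H.≟ y) ×-dec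
    G.∀? (λ x → g (f x) G.≟ x) ×-dec
    G.∀? (λ u → G.∀? (λ v →
      ((u G.~? v) →-dec (f u H.~? f v)) ×-dec ((f u H.~? f v) →-dec (u G.~? v))))

  resp : ∀ {f f′ g g′} → f ≗ f′ → g ≗ g′ → IsIso f g → IsIso f′ g′
  resp {f} {f′} {g} {g′} f≗ g≗ (fg , gf , adj) =
    (λ y → trans (sym (trans (f≗ (g y)) (cong f′ (g≗ y)))) (fg y)) ,
    (λ x → trans (sym (trans (g≗ (f x)) (cong g′ (f≗ x)))) (gf x)) ,
    (λ u v → (λ e → subst₂ H._~_ (f≗ u) (f≗ v) (proj₁ (adj u v) e)) ,
             (λ e → proj₂ (adj u v) (subst₂ H._~_ (sym (f≗ u)) (sym (f≗ v)) e)))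

------------------------------------------------------------------------
-- Distance

IsMinimum : Pred ℕ ℓ → Pred ℕ ℓ
IsMinimum P d = P d × (∀ e → P e → d ≤ e)

isMinimum? : {P : Pred ℕ ℓ} → Decidable P → Decidable (IsMinimum P)
isMinimum? P? d = map′
  (λ (p , h) → p , λ e q → ≮⇒≥ (λ e<d → h e<d q))
  (λ (p , h) → p , λ {e} e<d q → contradiction (h e q) (<⇒≱ e<d))
  (P? d ×-dec allUpTo? (λ e → ¬? (P? e)) d)

module _ (G : Graph) where
  open Graph G hiding (Vertex; size)

  Walk : Vertex G → Vertex G → ℕ → Set
  Walk u v zero    = u ≡ v
  Walk u v (suc l) = ∃ λ w → u ~ w × Walk w v l

  walk? : ∀ u v → Decidable (Walk u v)
  walk? u v zero    = u ≟ v
  walk? u v (suc l) = ∃? (λ w → (u ~? w) ×-dec walk? w v l)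

  -- `Distance u v d` says d_G(u,v) = d; it holds for no d when u and v lie
  -- in different components.
  Distance : Vertex G → Vertex G → ℕ → Set
  Distance u v = IsMinimum (Walk u v)

  distance? : ∀ u v → Decidable (Distance u v)
  distance? u v = isMinimum? (walk? u v)

  VertexSet : Set
  VertexSet = Subset (size G)

  _∈ᵥ_ : Vertex G → VertexSet → Set
  v ∈ᵥ S = index v ∈ S

  DistanceToSet : Vertex G → VertexSet → ℕ → Set
  DistanceToSet u S = IsMinimum (λ d → ∃ λ v → v ∈ᵥ S × Distance u v d)

  distanceToSet? : ∀ u S → Decidable (DistanceToSet u S)
  distanceToSet? u S =
    isMinimum? (λ d → ∃? (λ v → (index v ∈? S) ×-dec distance? u v d))

  -- The induced subgraphs of G correspond one-to-one to its vertex sets.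
  inducedOn : VertexSet → Graph
  inducedOn S = induced G (λ v → index v ∈? S)

------------------------------------------------------------------------
-- Hypercubes and daisy cubes

Word : ℕ → Set
Word n = Vec Bool n

0ʷ : Word n
0ʷ = replicate _ false

infix 4 _≤ʷ_ _≤ʷ?_

_≤ʷ_ : Rel (Word n) 0ℓ
_≤ʷ_ = Pointwise Bool._≤_

_≤ʷ?_ : Binary.Decidable (_≤ʷ_ {n})
_≤ʷ?_ = Pointwise.decidable Bool._≤?_

0ʷ≤ : (u : Word n) → 0ʷ ≤ʷ u
0ʷ≤ []      = []
0ʷ≤ (b ∷ u) = Bool.≤-minimum b ∷ 0ʷ≤ u

DifferInOne : Rel (Word n) 0ℓ
DifferInOne u v = ∃! _≡_ λ i → lookup u i ≢ lookup v i

differInOne? : Binary.Decidable (DifferInOne {n})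
differInOne? u v = any? λ i → differ? i ×-dec
  map′ (λ h {j} → h j) (λ h j → h) (all? λ j → differ? j →-dec (i Fin.≟ j))
  where
  differ? : Decidable (λ i → lookup u i ≢ lookup v i)
  differ? i = ¬? (lookup u i Bool.≟ lookup v i)

Q : ℕ → Graph
Q n = record
  { Vertex   = Word n
  ; finite   = Vec-Bool-finite n
  ; _~_      = DifferInOne
  ; _~?_     = differInOne?
  ; ~-sym    = λ (i , u≢v , unique) → i , u≢v ∘ sym , λ v≢u → unique (v≢u ∘ sym)
  ; ~-irrefl = λ { refl (i , u≢u , _) → u≢u refl }
  }

module _ {n : ℕ} {X : Pred (Word n) ℓ} (X? : Decidable X) where

  Below : Pred (Word n) ℓ
  Below u = ∃ λ x → X x × u ≤ʷ x

  below? : Decidable Below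
  below? u = Finite.∃? (Vec-Bool-finite n) (λ x → X? x ×-dec (u ≤ʷ? x))

  daisyCube : Graph
  daisyCube = induced (Q n) below?

  daisyOrigin : Satisfiable X → Vertex daisyCube
  daisyOrigin (x , x∈X) = 0ʷ , fromWitness (x , x∈X , 0ʷ≤ x)

------------------------------------------------------------------------
-- Polynomials: R[t] as lists of coefficients in order of increasing degree,
-- equal when all coefficients agree (so trailing zeros are ignored).

module _ {c ℓ} (R : RawRing c ℓ) where
  private module R = RawRing R

  coefficient : List R.Carrier → ℕ → R.Carrier
  coefficient []      _       = R.0#
  coefficient (a ∷ p) zero    = a
  coefficient (a ∷ p) (suc i) = coefficient p i

  addPoly : List R.Carrier → List R.Carrier → List R.Carrier
  addPoly []      q       = q
  addPoly (a ∷ p) []      = a ∷ p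
  addPoly (a ∷ p) (b ∷ q) = (a R.+ b) ∷ addPoly p q

  mulPoly : List R.Carrier → List R.Carrier → List R.Carrier
  mulPoly []      q = []
  mulPoly (a ∷ p) q = addPoly (List.map (a R.*_) q) (R.0# ∷ mulPoly p q)

  Poly : RawRing c ℓ
  Poly = record
    { Carrier = List R.Carrier
    ; _≈_     = λ p q → ∀ i → coefficient p i R.≈ coefficient q i
    ; _+_     = addPoly
    ; _*_     = mulPoly
    ; -_      = List.map (R.-_)
    ; 0#      = []
    ; 1#      = R.1# ∷ []
    }

  const : R.Carrier → RawRing.Carrier Poly
  const a = a ∷ []

  indeterminate : RawRing.Carrier Poly
  indeterminate = R.0# ∷ R.1# ∷ []

ℤ[x] : RawRing 0ℓ 0ℓ
ℤ[x] = Poly +-*-rawRing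

-- (ℤ[x])[y]: a list, indexed by the degree in y, of polynomials in x.
ℤ[x,y] : RawRing 0ℓ 0ℓ
ℤ[x,y] = Poly ℤ[x]

x y : RawRing.Carrier ℤ[x,y]
x = const ℤ[x] (indeterminate +-*-rawRing)
y = indeterminate ℤ[x]

infix 9 _⟨_⟩

_⟨_⟩ : RawRing.Carrier ℤ[x] → RawRing.Carrier ℤ[x,y] → RawRing.Carrier ℤ[x,y]
[]      ⟨ z ⟩ = RawRing.0# ℤ[x,y]
(a ∷ p) ⟨ z ⟩ = const ℤ[x] (const +-*-rawRing a) + z * p ⟨ z ⟩
  where open RawRing ℤ[x,y] using (_+_; _*_)

------------------------------------------------------------------------
-- Cube polynomials

module _ (G : Graph) where

  private module VertexSets = Finite (Vec-Bool-finite (size G))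

  cubeCount : ℕ → ℕ
  cubeCount k = VertexSets.count (λ S → inducedOn G S ≅? Q k)

  cubeCountAt : Vertex G → ℕ → ℕ → ℕ
  cubeCountAt u k d = VertexSets.count
    (λ S → (inducedOn G S ≅? Q k) ×-dec distanceToSet? G u S d)

  -- The sums over k and d may be cut off at |V(G)|: an induced Q_k forces
  -- k < 2^k ≤ |V(G)|, and finite distances in G are less than |V(G)|.
  cubePolynomial : RawRing.Carrier ℤ[x]
  cubePolynomial = List.map (λ k → + cubeCount k) (upTo (size G))

  distanceCubePolynomial : Vertex G → RawRing.Carrier ℤ[x,y]
  distanceCubePolynomial u =
    List.map (λ d → List.map (λ k → + cubeCountAt u k d) (upTo (size G)))
             (upTo (size G))

{-# OPTIONS --safe #-}

-- An induced Q_k in a daisy cube is a face of the hypercube whose top t lies in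
-- the daisy cube, and conversely; since geodesics from 0ⁿ can be chosen
-- increasing, its distance to 0ⁿ is the weight of its bottom, i.e. |t| − k.
-- There are |t| C k faces of dimension k with top t, so each vertex t
-- contributes (x + 1)^|t| to C_G(x) and (x + y)^|t| to D_{G,0ⁿ}(x,y), and
-- substituting x + y − 1 for x turns the former into the latter.

module Submission where

open import Defs
open import Level using (Level)
open import Data.Nat.Base using (ℕ)
open import Relation.Unary using (Pred; Decidable; Satisfiable)
open import Algebra.Bundles.Raw using (RawRing)

open import Data.Bool.Base as Bool using (Bool; true; false; not; T; f≤t; b≤b; if_then_else_)
import Data.Bool.Properties as Bool
open import Data.Empty using (⊥)
open import Data.Fin.Base using (Fin; zero; suc)
import Data.Fin.Properties as Fin
open import Data.Fin.Subset using (∣_∣; _⊆_) renaming (_∈_ to _∈ˢ_)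
open import Data.Fin.Subset.Properties using (⊆-antisym)
open import Data.Integer.Base as ℤ using (ℤ; +_; +-*-rawRing)
import Data.Integer.Properties as ℤ
open import Data.Integer.Tactic.RingSolver using (solve-∀)
open import Data.List.Base
  using (List; []; _∷_; _++_; length; map; filter; concatMap; applyUpTo; upTo)
open import Data.List.Properties
  using (length-map; length-++; map-upTo; filter-accept; filter-reject; filter-none)
open import Data.List.Membership.Propositional using (_∈_; find; lose)
open import Data.List.Membership.Propositional.Properties
  using (∈-map⁺; ∈-map⁻; ∈-++⁺ˡ; ∈-++⁺ʳ; ∈-++⁻; ∈-filter⁺; ∈-filter⁻;
         ∈-tabulate⁺; ∈-concatMap⁺; ∈-concatMap⁻)
open import Data.List.Membership.Propositional.Properties.WithK using (unique∧set⇒bag)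
open import Data.List.Relation.Binary.BagAndSetEquality using (∼bag⇒↭)
open import Data.List.Relation.Binary.Permutation.Propositional.Properties using (↭-length)
open import Data.List.Relation.Unary.All as All using ([]; _∷_)
import Data.List.Relation.Unary.All.Properties as All
open import Data.List.Relation.Unary.Any using (here; there)
open import Data.List.Relation.Unary.Unique.Propositional using (Unique; []; _∷_)
import Data.List.Relation.Unary.Unique.Propositional.Properties as Unique
open import Data.Nat.Base as ℕ using (zero; suc; _≤_; _<_; z≤n; s≤s; _^_; _≡ᵇ_)
open import Data.Nat.Combinatorics using (_C_; nCk+nC[k+1]≡[n+1]C[k+1]; nCk≡nC[n∸k]; nCn≡1)
import Data.Nat.Properties as ℕ
open import Data.Product.Base using (∃; _×_; _,_; proj₁; proj₂)
open import Data.Sum.Base using (_⊎_; inj₁; inj₂; [_,_]′)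
open import Data.Vec.Base as Vec using ([]; _∷_; lookup; updateAt)
open import Data.Vec.Properties as Vec
  using (updateAt-updateAt; updateAt-id-local; lookup∘updateAt; lookup∘updateAt′;
         lookup∘tabulate; lookup⇒[]=; []=⇒lookup)
open import Data.Vec.Relation.Binary.Pointwise.Inductive as Pointwise using ([]; _∷_)
open import Function.Base using (_∘_)
open import Function.Bundles using (_⇔_; mk⇔; mk↔ₛ′; Equivalence; Inverse; Injection)
open import Function.Definitions using (Injective)
open import Function.Properties.Inverse using (↔⇒↣; ↔-sym)
open import Relation.Binary.PropositionalEquality
  using (_≡_; _≢_; _≗_; refl; sym; trans; cong; cong₂; subst; subst₂; module ≡-Reasoning)
open import Relation.Nullary.Decidable
  using (Dec; yes; no; does; map′; _×-dec_; toWitness; fromWitness; dec-true; dec-false)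
open import Relation.Nullary.Negation using (contradiction)

private
  variable
    a c ℓ : Level
    A B : Set a
    k n : ℕ

-- Adjacency in the hypercube

-- An induced cube is given only by an abstract isomorphism with `Q k`, so that it is a face has to
-- be recovered from adjacency alone: the edges joining two opposite halves must all run in one
-- direction. Grouping faces by their top `t` puts both counts over the same index set. As weight of
-- the top = k + weight of the bottom, prescribing the distance d just keeps the tops of weight k +
-- d. The identity then splits over the vertices and, for a single weight m, reads (1 + (x + y -
-- 1))^m = (x + y)^m. Both polynomials are cut off at the number N of vertices, so the binomial
-- theorem is needed for truncated sums and must be exact there. It is, because a vertex of weight m
-- brings along the 2^m words below it, whence m < 2^m ≤ N. The substitution is evaluated
-- coefficient by coefficient, with multiplication by x and y acting as shifts.

flip : Fin n → Word n → Word n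
flip i u = updateAt u i not

flip-involutive : (i : Fin n) (u : Word n) → flip i (flip i u) ≡ u
flip-involutive i u =
  trans (updateAt-updateAt i u) (updateAt-id-local i u (Bool.not-involutive _))

-- An inductive form of `DifferInOne`: the differing position is the depth of `here`, which permits
-- recursion along words and faces.
data Adjacent : Word n → Word n → Set where
  here  : ∀ {b} {u : Word n} → Adjacent (b ∷ u) (not b ∷ u)
  there : ∀ {b} {u v : Word n} → Adjacent u v → Adjacent (b ∷ u) (b ∷ v)

∷-adjacent : ∀ b c (u : Word n) → b ≢ c → Adjacent (b ∷ u) (c ∷ u)
∷-adjacent false false u b≢c = contradiction refl b≢c
∷-adjacent false true  u b≢c = here
∷-adjacent true  false u b≢c = here
∷-adjacent true  true  u b≢c = contradiction refl b≢c

lookup-injective : (u v : Word n) → lookup u ≗ lookup v → u ≡ v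
lookup-injective []      []      eq = refl
lookup-injective (b ∷ u) (c ∷ v) eq =
  cong₂ _∷_ (eq zero) (lookup-injective u v (eq ∘ suc))

differInOne⇒adjacent : (u v : Word n) → DifferInOne u v → Adjacent u v
differInOne⇒adjacent (b ∷ u) (c ∷ v) (zero , b≢c , unique) =
  subst (λ w → Adjacent (b ∷ u) (c ∷ w)) (lookup-injective u v same) (∷-adjacent b c u b≢c)
  where
  same : lookup u ≗ lookup v
  same j with lookup u j Bool.≟ lookup v j
  ... | yes eq = eq
  ... | no neq with () ← unique {suc j} neq
differInOne⇒adjacent (b ∷ u) (c ∷ v) (suc i , differ , unique)
  with b Bool.≟ c
... | no b≢c with () ← unique {zero} b≢c
... | yes refl = there (differInOne⇒adjacent u v
  (i , differ , λ neq → Fin.suc-injective (unique neq)))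

adjacent⇒differInOne : {u v : Word n} → Adjacent u v → DifferInOne u v
adjacent⇒differInOne here = zero , Bool.not-¬ refl ,
  λ { {zero} _ → refl ; {suc j} neq → contradiction refl neq }
adjacent⇒differInOne (there adj) =
  let i , differ , unique = adjacent⇒differInOne adj in
  suc i , differ , λ { {zero} neq → contradiction refl neq
                     ; {suc j} neq → cong suc (unique neq) }

adjacent-flip : (i : Fin n) (u : Word n) → Adjacent u (flip i u)
adjacent-flip zero    (b ∷ u) = here
adjacent-flip (suc i) (b ∷ u) = there (adjacent-flip i u)

adjacent⇒flip : {u v : Word n} → Adjacent u v → ∃ λ i → v ≡ flip i u
adjacent⇒flip here        = zero , refl
adjacent⇒flip (there adj) =
  let i , eq = adjacent⇒flip adj in suc i , cong (_ ∷_) eq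

∣∣-adjacent : {u v : Word n} → Adjacent u v → ∣ v ∣ ≤ suc ∣ u ∣
∣∣-adjacent (here {b = false})       = ℕ.≤-refl
∣∣-adjacent (here {b = true})        = ℕ.m≤n⇒m≤1+n (ℕ.n≤1+n _)
∣∣-adjacent (there {b = false} adj)  = ∣∣-adjacent adj
∣∣-adjacent (there {b = true} adj)   = s≤s (∣∣-adjacent adj)

∣0ʷ∣≡0 : ∀ n → ∣ 0ʷ {n} ∣ ≡ 0
∣0ʷ∣≡0 zero    = refl
∣0ʷ∣≡0 (suc n) = ∣0ʷ∣≡0 n

≤ʷ-trans : {u v w : Word n} → u ≤ʷ v → v ≤ʷ w → u ≤ʷ w
≤ʷ-trans = Pointwise.trans Bool.≤-trans

∣∣-mono : {u v : Word n} → u ≤ʷ v → ∣ u ∣ ≤ ∣ v ∣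
∣∣-mono []                     = z≤n
∣∣-mono (f≤t ∷ u≤v)            = ℕ.m≤n⇒m≤1+n (∣∣-mono u≤v)
∣∣-mono (b≤b {false} ∷ u≤v)    = ∣∣-mono u≤v
∣∣-mono (b≤b {true} ∷ u≤v)     = s≤s (∣∣-mono u≤v)

≤ʷ∧∣∣≡⇒≡ : {u v : Word n} → u ≤ʷ v → ∣ v ∣ ≡ ∣ u ∣ → u ≡ v
≤ʷ∧∣∣≡⇒≡ []                  eq = refl
≤ʷ∧∣∣≡⇒≡ (f≤t ∷ u≤v)         eq = contradiction (ℕ.≤-reflexive eq) (ℕ.<⇒≱ (s≤s (∣∣-mono u≤v)))
≤ʷ∧∣∣≡⇒≡ (b≤b {false} ∷ u≤v) eq = cong (false ∷_) (≤ʷ∧∣∣≡⇒≡ u≤v eq)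
≤ʷ∧∣∣≡⇒≡ (b≤b {true} ∷ u≤v)  eq = cong (true ∷_) (≤ʷ∧∣∣≡⇒≡ u≤v (ℕ.suc-injective eq))

-- The first coordinate in which `u` and `v` differ is raised. The weight equation guarantees that
-- there is one and leaves a climb of `l` steps.
step-up : ∀ l {u v : Word n} → u ≤ʷ v → ∣ v ∣ ≡ suc l ℕ.+ ∣ u ∣ →
          ∃ λ w → Adjacent u w × w ≤ʷ v × ∣ v ∣ ≡ l ℕ.+ ∣ w ∣
step-up l []                  ()
step-up l {false ∷ u} (f≤t ∷ u≤v) eq =
  true ∷ u , here , b≤b ∷ u≤v , trans eq (sym (ℕ.+-suc l _))
step-up l (b≤b {false} ∷ u≤v) eq =
  let w , adj , w≤v , eq′ = step-up l u≤v eq in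
  false ∷ w , there adj , b≤b ∷ w≤v , eq′
step-up l {true ∷ u} (b≤b {true} ∷ u≤v) eq =
  let w , adj , w≤v , eq′ = step-up l u≤v (trans (ℕ.suc-injective eq) (ℕ.+-suc l _)) in
  true ∷ w , there adj , b≤b ∷ w≤v , trans (cong suc eq′) (sym (ℕ.+-suc l _))

-- Faces of the hypercube

-- A face is a word over 0, 1 and a joker; the second index counts the jokers, so the dimension is
-- part of the type.
data Face : ℕ → ℕ → Set where
  []    : Face 0 0
  fixed : Bool → Face n k → Face (suc n) k
  free  : Face n k → Face (suc n) (suc k)

infix 4 _∈ᶠ_ _∈ᶠ?_

data _∈ᶠ_ : Word n → Face n k → Set where
  []    : [] ∈ᶠ []
  fixed : ∀ {b} {v : Word n} {F : Face n k} → v ∈ᶠ F → b ∷ v ∈ᶠ fixed b F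
  free  : ∀ {b} {v : Word n} {F : Face n k} → v ∈ᶠ F → b ∷ v ∈ᶠ free F

_∈ᶠ?_ : (v : Word n) (F : Face n k) → Dec (v ∈ᶠ F)
[]      ∈ᶠ? []        = yes []
(b ∷ v) ∈ᶠ? fixed c F =
  map′ (λ { (refl , v∈F) → fixed v∈F }) (λ { (fixed v∈F) → refl , v∈F })
       ((b Bool.≟ c) ×-dec (v ∈ᶠ? F))
(b ∷ v) ∈ᶠ? free F    = map′ free (λ { (free v∈F) → v∈F }) (v ∈ᶠ? F)

point : Face n k → Word k → Word n
point []          w       = []
point (fixed b F) w       = b ∷ point F w
point (free F)    (b ∷ w) = b ∷ point F w

coordinates : Face n k → Word n → Word k
coordinates []          v       = []
coordinates (fixed _ F) (_ ∷ v) = coordinates F v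
coordinates (free F)    (b ∷ v) = b ∷ coordinates F v

bottom top : Face n k → Word n
bottom []          = []
bottom (fixed b F) = b ∷ bottom F
bottom (free F)    = false ∷ bottom F
top []          = []
top (fixed b F) = b ∷ top F
top (free F)    = true ∷ top F

point∈ : (F : Face n k) (w : Word k) → point F w ∈ᶠ F
point∈ []          w       = []
point∈ (fixed b F) w       = fixed (point∈ F w)
point∈ (free F)    (b ∷ w) = free (point∈ F w)

bottom∈ : (F : Face n k) → bottom F ∈ᶠ F
bottom∈ []          = []
bottom∈ (fixed b F) = fixed (bottom∈ F)
bottom∈ (free F)    = free (bottom∈ F)

top∈ : (F : Face n k) → top F ∈ᶠ F
top∈ []          = []
top∈ (fixed b F) = fixed (top∈ F)
top∈ (free F)    = free (top∈ F)

bottom≤ : {v : Word n} {F : Face n k} → v ∈ᶠ F → bottom F ≤ʷ v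
bottom≤ []          = []
bottom≤ (fixed v∈F) = b≤b ∷ bottom≤ v∈F
bottom≤ (free v∈F)  = Bool.≤-minimum _ ∷ bottom≤ v∈F

≤top : {v : Word n} {F : Face n k} → v ∈ᶠ F → v ≤ʷ top F
≤top []          = []
≤top (fixed v∈F) = b≤b ∷ ≤top v∈F
≤top (free v∈F)  = Bool.≤-maximum _ ∷ ≤top v∈F

∣top∣ : (F : Face n k) → ∣ top F ∣ ≡ k ℕ.+ ∣ bottom F ∣
∣top∣ []                  = refl
∣top∣ (fixed false F)     = ∣top∣ F
∣top∣ {k = k} (fixed true F) = trans (cong suc (∣top∣ F)) (sym (ℕ.+-suc k _))
∣top∣ (free F)            = cong suc (∣top∣ F)

coordinates-point : (F : Face n k) (w : Word k) → coordinates F (point F w) ≡ w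
coordinates-point []          []      = refl
coordinates-point (fixed _ F) w       = coordinates-point F w
coordinates-point (free F)    (b ∷ w) = cong (b ∷_) (coordinates-point F w)

point-coordinates : {v : Word n} {F : Face n k} → v ∈ᶠ F → point F (coordinates F v) ≡ v
point-coordinates []          = refl
point-coordinates (fixed v∈F) = cong (_ ∷_) (point-coordinates v∈F)
point-coordinates (free v∈F)  = cong (_ ∷_) (point-coordinates v∈F)

coordinates-adjacent : {u v : Word n} {F : Face n k} → u ∈ᶠ F → v ∈ᶠ F →
                       Adjacent u v → Adjacent (coordinates F u) (coordinates F v)
coordinates-adjacent (fixed {b = false} _) () here
coordinates-adjacent (fixed {b = true} _)  () here
coordinates-adjacent (fixed u∈F) (fixed v∈F) (there adj) = coordinates-adjacent u∈F v∈F adj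
coordinates-adjacent (free _)    (free _)    here        = here
coordinates-adjacent (free u∈F)  (free v∈F)  (there adj) = there (coordinates-adjacent u∈F v∈F adj)

point-adjacent : (F : Face n k) {w w′ : Word k} →
                 Adjacent w w′ → Adjacent (point F w) (point F w′)
point-adjacent (fixed b F) adj         = there (point-adjacent F adj)
point-adjacent (free F)    here        = here
point-adjacent (free F)    (there adj) = there (point-adjacent F adj)

infix 4 _≐_

_≐_ : Face n k → Face n k → Set
F ≐ G = ∀ v → v ∈ᶠ F ⇔ v ∈ᶠ G

-- If one face fixes the first coordinate and the other frees it, a bottom word prefixed with the
-- opposite value lies in the free face only. If both fix it, the bottom of `F` forces the same
-- value.
face-extensional : (F G : Face n k) → F ≐ G → F ≡ G
face-extensional [] [] eq = refl
face-extensional (fixed b F) (fixed c G) eq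
  with fixed _ ← Equivalence.to (eq (b ∷ bottom F)) (fixed (bottom∈ F))
  = cong (fixed b) (face-extensional F G λ v → mk⇔
      (λ v∈F → case-fixed (Equivalence.to (eq _) (fixed v∈F)))
      (λ v∈G → case-fixed (Equivalence.from (eq _) (fixed v∈G))))
  where
  case-fixed : ∀ {b c} {v : Word n} {F : Face n k} → b ∷ v ∈ᶠ fixed c F → v ∈ᶠ F
  case-fixed (fixed v∈F) = v∈F
face-extensional (fixed false F) (free G) eq
  with () ← Equivalence.from (eq (true ∷ bottom G)) (free (bottom∈ G))
face-extensional (fixed true F) (free G) eq
  with () ← Equivalence.from (eq (false ∷ bottom G)) (free (bottom∈ G))
face-extensional (free F) (fixed false G) eq
  with () ← Equivalence.to (eq (true ∷ bottom F)) (free (bottom∈ F))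
face-extensional (free F) (fixed true G) eq
  with () ← Equivalence.to (eq (false ∷ bottom F)) (free (bottom∈ F))
face-extensional (free F) (free G) eq =
  cong free (face-extensional F G λ v → mk⇔
    (λ v∈F → case-free (Equivalence.to (eq (false ∷ v)) (free v∈F)))
    (λ v∈G → case-free (Equivalence.from (eq (false ∷ v)) (free v∈G))))
  where
  case-free : ∀ {b} {v : Word n} {F : Face n k} → b ∷ v ∈ᶠ free F → v ∈ᶠ F
  case-free (free v∈F) = v∈F

-- Cubes in the hypercube are faces

-- Clearing the ones of a word one at a time leads to `0ʷ` along edges. This spreads the direction
-- of one crossing edge to all of them.
connected : (g : Word k → A) → (∀ i w → g (flip i w) ≡ g w) → ∀ w → g w ≡ g 0ʷ
connected g inv []          = refl
connected g inv (false ∷ w) = connected (g ∘ (false ∷_)) (λ i w → inv (suc i) (false ∷ w)) w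
connected g inv (true ∷ w)  =
  trans (inv zero (false ∷ w)) (connected (g ∘ (false ∷_)) (λ i w → inv (suc i) (false ∷ w)) w)

-- Opposite edges of a 4-cycle have the same direction.
parallel : ∀ {i i′ j j′ : Fin n} u → flip i′ (flip j u) ≡ flip j′ (flip i u) →
           i ≢ j → i ≢ j′ → i′ ≡ i
parallel {i = i} {i′} {j} {j′} u eq i≢j i≢j′ with i Fin.≟ i′
... | yes i≡i′ = sym i≡i′
... | no  i≢i′ = contradiction (begin
    lookup u i                     ≡⟨ lookup∘updateAt′ i j i≢j u ⟨
    lookup (flip j u) i            ≡⟨ lookup∘updateAt′ i i′ i≢i′ (flip j u) ⟨
    lookup (flip i′ (flip j u)) i  ≡⟨ cong (λ v → lookup v i) eq ⟩
    lookup (flip j′ (flip i u)) i  ≡⟨ lookup∘updateAt′ i j′ i≢j′ (flip i u) ⟩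
    lookup (flip i u) i            ≡⟨ lookup∘updateAt i u ⟩
    not (lookup u i)               ∎) (Bool.not-¬ refl)
  where open ≡-Reasoning

-- `face` is the union of `F` and its mirror image along `i`. The disjunction in `sound` spares
-- naming the side on which `F` lies.
record Thickening (i : Fin n) (F : Face n k) : Set where
  field
    face  : Face n (suc k)
    sound : ∀ {v} → v ∈ᶠ face → v ∈ᶠ F ⊎ flip i v ∈ᶠ F
    keeps : ∀ {v} → v ∈ᶠ F → v ∈ᶠ face
    moves : ∀ {v} → v ∈ᶠ F → flip i v ∈ᶠ face

-- Either coordinate `i` is free in `F`, and `F` is closed under flipping it, or it is fixed, and
-- freeing it adds one dimension.
thicken : (i : Fin n) (F : Face n k) → (∀ {v} → v ∈ᶠ F → flip i v ∈ᶠ F) ⊎ Thickening i F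
thicken zero (free F)    = inj₁ λ { (free v∈F) → free v∈F }
thicken zero (fixed c F) = inj₂ record
  { face  = free F
  ; sound = λ { (free v∈F) → side _ c v∈F }
  ; keeps = λ { (fixed v∈F) → free v∈F }
  ; moves = λ { (fixed v∈F) → free v∈F }
  }
  where
  side : ∀ b c {v} → v ∈ᶠ F → b ∷ v ∈ᶠ fixed c F ⊎ not b ∷ v ∈ᶠ fixed c F
  side false false v∈F = inj₁ (fixed v∈F)
  side false true  v∈F = inj₂ (fixed v∈F)
  side true  false v∈F = inj₂ (fixed v∈F)
  side true  true  v∈F = inj₁ (fixed v∈F)
thicken (suc i) (free F) with thicken i F
... | inj₁ closed = inj₁ λ { (free v∈F) → free (closed v∈F) }
... | inj₂ θ = inj₂ record
  { face  = free face
  ; sound = λ { (free v∈) → [ inj₁ ∘ free , inj₂ ∘ free ]′ (sound v∈) }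
  ; keeps = λ { (free v∈F) → free (keeps v∈F) }
  ; moves = λ { (free v∈F) → free (moves v∈F) }
  }
  where
  open Thickening θ
thicken (suc i) (fixed c F) with thicken i F
... | inj₁ closed = inj₁ λ { (fixed v∈F) → fixed (closed v∈F) }
... | inj₂ θ = inj₂ record
  { face  = fixed c face
  ; sound = λ { (fixed v∈) → [ inj₁ ∘ fixed , inj₂ ∘ fixed ]′ (sound v∈) }
  ; keeps = λ { (fixed v∈F) → fixed (keeps v∈F) }
  ; moves = λ { (fixed v∈F) → fixed (moves v∈F) }
  }
  where
  open Thickening θ

-- By induction f maps the half {0} × Q_k onto a face. The edges joining it to
-- the other half are all parallel, to i say, so the image is that face thickened
-- along i; i is not free in the face already because f is injective.
cube-image : (f : Word k → Word n) → Injective _≡_ _≡_ f →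
             (∀ {w w′} → Adjacent w w′ → Adjacent (f w) (f w′)) →
             ∃ λ (F : Face n k) → ∀ v → v ∈ᶠ F ⇔ ∃ λ w → f w ≡ v
cube-image {zero} f inj hom = vertex (f []) , λ v → mk⇔
  (λ v∈ → [] , sym (vertex-only v∈)) (λ { ([] , refl) → vertex∈ (f []) })
  where
  vertex : Word n → Face n 0
  vertex []      = []
  vertex (b ∷ v) = fixed b (vertex v)

  vertex∈ : (v : Word n) → v ∈ᶠ vertex v
  vertex∈ []      = []
  vertex∈ (b ∷ v) = fixed (vertex∈ v)

  vertex-only : {u v : Word n} → u ∈ᶠ vertex v → u ≡ v
  vertex-only {v = []}    []         = refl
  vertex-only {v = b ∷ v} (fixed u∈) = cong (b ∷_) (vertex-only u∈)
cube-image {suc k} {n} f inj hom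
  with F , F⇔ ← cube-image (f ∘ (false ∷_)) (Vec.∷-injectiveʳ ∘ inj) (hom ∘ there)
  = from-thickening (thicken i F)
  where
  crossing : ∀ w → ∃ λ i → f (true ∷ w) ≡ flip i (f (false ∷ w))
  crossing w = adjacent⇒flip (hom here)

  direction : Word k → Fin n
  direction w = proj₁ (crossing w)

  i : Fin n
  i = direction 0ʷ

  -- The images of `false ∷ w`, `true ∷ w` and of their neighbours along `j` form a 4-cycle, to
  -- which `parallel` applies. Were `d` equal to `p` or to `q`, the ends of a diagonal of this cycle
  -- would coincide, against injectivity.
  direction-flip : ∀ j w → direction (flip j w) ≡ direction w
  direction-flip j w
    with p , eq-p ← adjacent⇒flip (hom (there {b = false} (adjacent-flip j w)))
    with q , eq-q ← adjacent⇒flip (hom (there {b = true} (adjacent-flip j w)))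
    with d , eq-d ← crossing w
    with d′ , eq-d′ ← crossing (flip j w)
    = parallel (f (false ∷ w))
        (trans (cong (flip d′) (sym eq-p)) (trans (sym eq-d′) (trans eq-q (cong (flip q) eq-d))))
        (λ { refl → contradiction (inj (trans eq-d (sym eq-p))) λ () })
        (λ { refl → contradiction
          (inj (trans eq-q (trans (cong (flip q) eq-d) (flip-involutive q _)))) λ () })

  crosses : ∀ w → f (true ∷ w) ≡ flip i (f (false ∷ w))
  crosses w = subst (λ d → f (true ∷ w) ≡ flip d (f (false ∷ w)))
    (connected direction direction-flip w) (proj₂ (crossing w))

  from-thickening : (∀ {v} → v ∈ᶠ F → flip i v ∈ᶠ F) ⊎ Thickening i F →
                    ∃ λ (F : Face n (suc k)) → ∀ v → v ∈ᶠ F ⇔ ∃ λ w → f w ≡ v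
  from-thickening (inj₁ closed)
    with w , eq ← Equivalence.to (F⇔ _) (closed (Equivalence.from (F⇔ _) (0ʷ , refl)))
    = contradiction (inj (trans eq (sym (crosses 0ʷ)))) λ ()
  from-thickening (inj₂ θ) = face , λ v → mk⇔ (image ∘ sound) λ
    { (false ∷ w , refl) → keeps (Equivalence.from (F⇔ _) (w , refl))
    ; (true ∷ w , refl) → subst (_∈ᶠ face) (sym (crosses w))
        (moves (Equivalence.from (F⇔ _) (w , refl))) }
    where
    open Thickening θ
    image : ∀ {v} → v ∈ᶠ F ⊎ flip i v ∈ᶠ F → ∃ λ w → f w ≡ v
    image (inj₁ v∈F) with w , eq ← Equivalence.to (F⇔ _) v∈F = false ∷ w , eq
    image (inj₂ v∈F) with w , eq ← Equivalence.to (F⇔ _) v∈F =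
      true ∷ w , trans (crosses w) (trans (cong (flip i) eq) (flip-involutive i _))

-- Counting faces

nC0≡1 : ∀ n → n C 0 ≡ 1
nC0≡1 n = trans (nCk≡nC[n∸k] {0} {n} z≤n) (nCn≡1 n)

elements-unique : (fin : Finite A) → Unique (Finite.elements fin)
elements-unique fin =
  Unique.tabulate⁺ (Injection.injective (↔⇒↣ (↔-sym (Finite.enum fin))))

∈-elements : (fin : Finite A) (x : A) → x ∈ Finite.elements fin
∈-elements fin x =
  subst (_∈ elements) (element-index x) (∈-tabulate⁺ (index x))
  where open Finite fin

-- Two duplicate-free lists with the same members are permutations of each other, so the objects
-- counted may be listed in any convenient order.
count≡length : (fin : Finite A) {P : Pred A ℓ} (P? : Decidable P) {xs : List A} → Unique xs →
               (∀ {x} → x ∈ xs → P x) → (∀ {x} → P x → x ∈ xs) →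
               Finite.count fin P? ≡ length xs
count≡length fin P? xs! sound complete = ↭-length (∼bag⇒↭ (unique∧set⇒bag
  (Unique.filter⁺ P? (elements-unique fin)) xs!
  (mk⇔ (complete ∘ proj₂ ∘ ∈-filter⁻ P? {xs = Finite.elements fin})
       (λ x∈xs → ∈-filter⁺ P? (∈-elements fin _) (sound x∈xs)))))

-- Injectivity is asked on the members of `xs` only: `vertexSet` may identify faces that stick out
-- of the daisy cube.
map-unique : {f : A → B} {xs : List A} →
             (∀ {x y} → x ∈ xs → y ∈ xs → f x ≡ f y → x ≡ y) →
             Unique xs → Unique (map f xs)
map-unique inj []          = []
map-unique inj (x∉xs ∷ xs!) =
  All.map⁺ (All.tabulate λ y∈xs eq → All.lookup x∉xs y∈xs (inj (here refl) (there y∈xs) eq)) ∷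
  map-unique (λ x∈ y∈ → inj (there x∈) (there y∈)) xs!

concatMap-unique : {f : A → List B} {xs : List A} → (∀ x → Unique (f x)) →
                   (∀ {x y z} → z ∈ f x → z ∈ f y → x ≡ y) →
                   Unique xs → Unique (concatMap f xs)
concatMap-unique f! disjoint []           = []
concatMap-unique {f = f} f! disjoint (_∷_ {x} {xs} x∉xs xs!) =
  Unique.++⁺ (f! x) (concatMap-unique f! disjoint xs!) λ (z∈fx , z∈rest) →
    let y , y∈xs , z∈fy = find (∈-concatMap⁻ f {xs} z∈rest)
    in All.lookup x∉xs y∈xs (disjoint z∈fx z∈fy)

-- The `k`-dimensional faces with a prescribed top: a zero of the top must be fixed, a one is either
-- free or fixed. The last clause is Pascal's rule, which yields the binomial in `length-faces`.
faces : Word n → (k : ℕ) → List (Face n k)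
faces []          zero    = [] ∷ []
faces []          (suc k) = []
faces (false ∷ t) k       = map (fixed false) (faces t k)
faces (true ∷ t)  zero    = map (fixed true) (faces t zero)
faces (true ∷ t)  (suc k) = map free (faces t k) ++ map (fixed true) (faces t (suc k))

∈-faces⁺ : (F : Face n k) → F ∈ faces (top F) k
∈-faces⁺ []                            = here refl
∈-faces⁺ (fixed false F)               = ∈-map⁺ (fixed false) (∈-faces⁺ F)
∈-faces⁺ {k = zero}  (fixed true F)    = ∈-map⁺ (fixed true) (∈-faces⁺ F)
∈-faces⁺ {k = suc k} (fixed true F)    =
  ∈-++⁺ʳ (map free (faces (top F) k)) (∈-map⁺ (fixed true) (∈-faces⁺ F))
∈-faces⁺ (free F)                      = ∈-++⁺ˡ (∈-map⁺ free (∈-faces⁺ F))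

∈-faces⁻ : (t : Word n) {F : Face n k} → F ∈ faces t k → top F ≡ t
∈-faces⁻ {k = zero} [] (here refl) = refl
∈-faces⁻ (false ∷ t) F∈ with _ , F∈ , refl ← ∈-map⁻ (fixed false) F∈ =
  cong (false ∷_) (∈-faces⁻ t F∈)
∈-faces⁻ {k = zero} (true ∷ t) F∈ with _ , F∈ , refl ← ∈-map⁻ (fixed true) F∈ =
  cong (true ∷_) (∈-faces⁻ t F∈)
∈-faces⁻ {k = suc k} (true ∷ t) F∈ with ∈-++⁻ (map free (faces t k)) F∈
... | inj₁ F∈ with _ , F∈ , refl ← ∈-map⁻ free F∈ = cong (true ∷_) (∈-faces⁻ t F∈)
... | inj₂ F∈ with _ , F∈ , refl ← ∈-map⁻ (fixed true) F∈ = cong (true ∷_) (∈-faces⁻ t F∈)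

faces-unique : (t : Word n) (k : ℕ) → Unique (faces t k)
faces-unique []          zero    = [] ∷ []
faces-unique []          (suc k) = []
faces-unique (false ∷ t) k       = Unique.map⁺ (λ { refl → refl }) (faces-unique t k)
faces-unique (true ∷ t)  zero    = Unique.map⁺ (λ { refl → refl }) (faces-unique t zero)
faces-unique (true ∷ t)  (suc k) = Unique.++⁺
  (Unique.map⁺ (λ { refl → refl }) (faces-unique t k))
  (Unique.map⁺ (λ { refl → refl }) (faces-unique t (suc k)))
  λ (F∈free , F∈fixed) → case-disjoint (∈-map⁻ free F∈free) (∈-map⁻ (fixed true) F∈fixed)
  where
  case-disjoint : ∀ {F} → ∃ (λ G → G ∈ faces t k × F ≡ free G) →
                  ∃ (λ G → G ∈ faces t (suc k) × F ≡ fixed true G) → ⊥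
  case-disjoint (_ , _ , refl) (_ , _ , ())

length-faces : (t : Word n) (k : ℕ) → length (faces t k) ≡ ∣ t ∣ C k
length-faces []          zero    = refl
length-faces []          (suc k) = refl
length-faces (false ∷ t) k       = trans (length-map _ (faces t k)) (length-faces t k)
length-faces (true ∷ t)  zero    = begin
  length (map (fixed true) (faces t 0))  ≡⟨ length-map _ (faces t 0) ⟩
  length (faces t 0)                     ≡⟨ length-faces t 0 ⟩
  ∣ t ∣ C 0                              ≡⟨ nC0≡1 ∣ t ∣ ⟩
  1                                      ≡⟨ nC0≡1 (suc ∣ t ∣) ⟨
  suc ∣ t ∣ C 0                          ∎
  where open ≡-Reasoning
length-faces (true ∷ t)  (suc k) = begin
  length (map free (faces t k) ++ map (fixed true) (faces t (suc k)))
    ≡⟨ length-++ (map free (faces t k)) ⟩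
  length (map free (faces t k)) ℕ.+ length (map (Face.fixed true) (faces t (suc k)))
    ≡⟨ cong₂ ℕ._+_ (length-map free (faces t k)) (length-map _ (faces t (suc k))) ⟩
  length (faces t k) ℕ.+ length (faces t (suc k))
    ≡⟨ cong₂ ℕ._+_ (length-faces t k) (length-faces t (suc k)) ⟩
  ∣ t ∣ C k ℕ.+ ∣ t ∣ C suc k
    ≡⟨ nCk+nC[k+1]≡[n+1]C[k+1] ∣ t ∣ k ⟩
  suc ∣ t ∣ C suc k ∎
  where open ≡-Reasoning

module _ (G : Graph) {S : List (VertexSet G)} (S! : Unique S) where

  cubeCount≡length : ∀ k → (∀ {H} → H ∈ S → inducedOn G H ≅ Q k) →
                     (∀ {H} → inducedOn G H ≅ Q k → H ∈ S) → cubeCount G k ≡ length S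
  cubeCount≡length k = count≡length (Vec-Bool-finite (Graph.size G)) (λ H → inducedOn G H ≅? Q k) S!

  cubeCountAt≡length : ∀ u k d →
    (∀ {H} → H ∈ S → inducedOn G H ≅ Q k × DistanceToSet G u H d) →
    (∀ {H} → inducedOn G H ≅ Q k × DistanceToSet G u H d → H ∈ S) →
    cubeCountAt G u k d ≡ length S
  cubeCountAt≡length u k d = count≡length (Vec-Bool-finite (Graph.size G))
    (λ H → (inducedOn G H ≅? Q k) ×-dec distanceToSet? G u H d) S!

-- Coefficients of C(x + y − 1)

Coefficients : Set
Coefficients = ℕ → ℕ → ℤ

-- ⟦ p ⟧ d k is the coefficient of xᵏyᵈ.
⟦_⟧ : RawRing.Carrier ℤ[x,y] → Coefficients
⟦ p ⟧ d k = coefficient +-*-rawRing (coefficient ℤ[x] p d) k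

monomial : ℤ → Coefficients
monomial a zero    zero    = a
monomial a zero    (suc k) = ℤ.0ℤ
monomial a (suc d) k       = ℤ.0ℤ

x·_ y·_ [x+y-1]·_ : Coefficients → Coefficients
(x· e) d zero    = ℤ.0ℤ
(x· e) d (suc k) = e d k
(y· e) zero    k = ℤ.0ℤ
(y· e) (suc d) k = e d k
([x+y-1]· e) d k = (x· e) d k ℤ.+ (y· e) d k ℤ.- e d k

-- horner N c is Σ_{i<N} c i (x + y − 1)ⁱ; it is linear in c.
horner : ℕ → (ℕ → ℤ) → Coefficients
horner zero    c d k = ℤ.0ℤ
horner (suc N) c d k = monomial (c 0) d k ℤ.+ ([x+y-1]· horner N (λ i → c (suc i))) d k

x+y-1 : RawRing.Carrier ℤ[x,y]
x+y-1 = x R.+ y R.+ (R.- R.1#)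
  where module R = RawRing ℤ[x,y]

-- Polynomial arithmetic on coefficients

coefficient-+ : ∀ p q k → coefficient +-*-rawRing (addPoly +-*-rawRing p q) k ≡
                coefficient +-*-rawRing p k ℤ.+ coefficient +-*-rawRing q k
coefficient-+ []      q       k       = sym (ℤ.+-identityˡ _)
coefficient-+ (a ∷ p) []      k       = sym (ℤ.+-identityʳ _)
coefficient-+ (a ∷ p) (b ∷ q) zero    = refl
coefficient-+ (a ∷ p) (b ∷ q) (suc k) = coefficient-+ p q k

⟦⟧-+ : ∀ p q d k → ⟦ addPoly ℤ[x] p q ⟧ d k ≡ ⟦ p ⟧ d k ℤ.+ ⟦ q ⟧ d k
⟦⟧-+ []      q       d       k = sym (ℤ.+-identityˡ _)
⟦⟧-+ (a ∷ p) []      d       k = sym (ℤ.+-identityʳ _)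
⟦⟧-+ (a ∷ p) (b ∷ q) zero    k = coefficient-+ a b k
⟦⟧-+ (a ∷ p) (b ∷ q) (suc d) k = ⟦⟧-+ p q d k

coefficient-scale : ∀ a p k → coefficient +-*-rawRing (map (a ℤ.*_) p) k ≡
                    a ℤ.* coefficient +-*-rawRing p k
coefficient-scale a []      k       = sym (ℤ.*-zeroʳ a)
coefficient-scale a (b ∷ p) zero    = refl
coefficient-scale a (b ∷ p) (suc k) = coefficient-scale a p k

-- `mulPoly p []` is a list of zeros as long as `p`, equal to `[]` only coefficientwise.
coefficient-*-zero : ∀ p k → coefficient +-*-rawRing (mulPoly +-*-rawRing p []) k ≡ ℤ.0ℤ
coefficient-*-zero []      k       = refl
coefficient-*-zero (a ∷ p) zero    = refl
coefficient-*-zero (a ∷ p) (suc k) = coefficient-*-zero p k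

⟦⟧-scale : ∀ p q d k → ⟦ map (mulPoly +-*-rawRing p) q ⟧ d k ≡
           coefficient +-*-rawRing (mulPoly +-*-rawRing p (coefficient ℤ[x] q d)) k
⟦⟧-scale p []      d       k = sym (coefficient-*-zero p k)
⟦⟧-scale p (a ∷ q) zero    k = refl
⟦⟧-scale p (a ∷ q) (suc d) k = ⟦⟧-scale p q d k

-- Multiplying by a one-term list leaves behind the summand `0# ∷ []`, here over ℤ and below over
-- ℤ[x].
coefficient-[0] : ∀ k → coefficient +-*-rawRing (ℤ.0ℤ ∷ []) k ≡ ℤ.0ℤ
coefficient-[0] zero    = refl
coefficient-[0] (suc k) = refl

⟦[0]⟧ : ∀ d k → ⟦ [] ∷ [] ⟧ d k ≡ ℤ.0ℤ
⟦[0]⟧ zero    k = refl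
⟦[0]⟧ (suc d) k = refl

-- As a polynomial in y, `x+y-1` computes to the list of `x-1` and the constant 1.
x-1 : RawRing.Carrier ℤ[x]
x-1 = ℤ.-1ℤ ∷ ℤ.1ℤ ∷ []

coefficient-x-1* : ∀ p k → coefficient +-*-rawRing (mulPoly +-*-rawRing x-1 p) k ≡
  (x· λ _ → coefficient +-*-rawRing p) 0 k ℤ.- coefficient +-*-rawRing p k
coefficient-x-1* p k = trans (coefficient-+ (map (ℤ.-1ℤ ℤ.*_) p) _ k)
  (trans (cong (ℤ._+ coefficient +-*-rawRing (ℤ.0ℤ ∷ addPoly +-*-rawRing (map (ℤ.1ℤ ℤ.*_) p) (ℤ.0ℤ ∷ [])) k)
    (coefficient-scale ℤ.-1ℤ p k)) (tail k))
  where
  tail : ∀ k → ℤ.-1ℤ ℤ.* coefficient +-*-rawRing p k ℤ.+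
               coefficient +-*-rawRing (ℤ.0ℤ ∷ addPoly +-*-rawRing (map (ℤ.1ℤ ℤ.*_) p) (ℤ.0ℤ ∷ [])) k ≡
               (x· λ _ → coefficient +-*-rawRing p) 0 k ℤ.- coefficient +-*-rawRing p k
  tail zero    = lemma (coefficient +-*-rawRing p 0)
    where
    lemma : ∀ a → ℤ.-1ℤ ℤ.* a ℤ.+ ℤ.0ℤ ≡ ℤ.0ℤ ℤ.- a
    lemma = solve-∀
  tail (suc k)
    rewrite coefficient-+ (map (ℤ.1ℤ ℤ.*_) p) (ℤ.0ℤ ∷ []) k
          | coefficient-scale ℤ.1ℤ p k | coefficient-[0] k
    = lemma (coefficient +-*-rawRing p (suc k)) (coefficient +-*-rawRing p k)
    where
    lemma : ∀ a b → ℤ.-1ℤ ℤ.* a ℤ.+ (ℤ.1ℤ ℤ.* b ℤ.+ ℤ.0ℤ) ≡ b ℤ.- a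
    lemma = solve-∀

coefficient-1* : ∀ p k → coefficient +-*-rawRing (mulPoly +-*-rawRing (ℤ.1ℤ ∷ []) p) k ≡
                 coefficient +-*-rawRing p k
coefficient-1* p k
  rewrite coefficient-+ (map (ℤ.1ℤ ℤ.*_) p) (ℤ.0ℤ ∷ []) k
        | coefficient-scale ℤ.1ℤ p k | coefficient-[0] k
  = trans (ℤ.+-identityʳ _) (ℤ.*-identityˡ _)

-- Since x + y - 1 = (x - 1) + 1·y, row `d` of the product is (x - 1) times row `d` of `q`, plus the
-- preceding row.
⟦x+y-1*⟧ : ∀ q d k → ⟦ mulPoly ℤ[x] x+y-1 q ⟧ d k ≡ ([x+y-1]· ⟦ q ⟧) d k
⟦x+y-1*⟧ q d k = trans (⟦⟧-+ (map (mulPoly +-*-rawRing x-1) q) _ d k)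
  (trans (cong (ℤ._+ ⟦ [] ∷ addPoly ℤ[x] (map (mulPoly +-*-rawRing (ℤ.1ℤ ∷ [])) q) ([] ∷ []) ⟧ d k)
    (trans (⟦⟧-scale x-1 q d k) (coefficient-x-1* (coefficient ℤ[x] q d) k))) (tail d k))
  where
  tail : ∀ d k → (x· λ _ → ⟦ q ⟧ d) 0 k ℤ.- ⟦ q ⟧ d k ℤ.+
         ⟦ [] ∷ addPoly ℤ[x] (map (mulPoly +-*-rawRing (ℤ.1ℤ ∷ [])) q) ([] ∷ []) ⟧ d k ≡
         ([x+y-1]· ⟦ q ⟧) d k
  tail zero zero    = ℤ.+-identityʳ _
  tail zero (suc k) = lemma (⟦ q ⟧ 0 k) _
    where
    lemma : ∀ a b → a ℤ.- b ℤ.+ ℤ.0ℤ ≡ a ℤ.+ ℤ.0ℤ ℤ.- b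
    lemma = solve-∀
  tail (suc d) k
    rewrite ⟦⟧-+ (map (mulPoly +-*-rawRing (ℤ.1ℤ ∷ [])) q) ([] ∷ []) d k
          | ⟦⟧-scale (ℤ.1ℤ ∷ []) q d k | coefficient-1* (coefficient ℤ[x] q d) k | ⟦[0]⟧ d k
    = trans (cong (λ a → a ℤ.- ⟦ q ⟧ (suc d) k ℤ.+ (⟦ q ⟧ d k ℤ.+ ℤ.0ℤ)) (x-row k))
            (lemma ((x· ⟦ q ⟧) (suc d) k) (⟦ q ⟧ (suc d) k) (⟦ q ⟧ d k))
    where
    -- `x·_` is defined by cases on `k`, so the shift of a single row and that of the whole array
    -- agree only after this split.
    x-row : ∀ k → (x· λ _ → ⟦ q ⟧ (suc d)) 0 k ≡ (x· ⟦ q ⟧) (suc d) k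
    x-row zero    = refl
    x-row (suc k) = refl
    lemma : ∀ a b c → a ℤ.- b ℤ.+ (c ℤ.+ ℤ.0ℤ) ≡ a ℤ.+ c ℤ.- b
    lemma = solve-∀

⟦const⟧ : ∀ a d k → ⟦ const ℤ[x] (const +-*-rawRing a) ⟧ d k ≡ monomial a d k
⟦const⟧ a zero    zero    = refl
⟦const⟧ a zero    (suc k) = refl
⟦const⟧ a (suc d) k       = refl

x·-cong : ∀ {e e′} → (∀ d k → e d k ≡ e′ d k) → ∀ d k → (x· e) d k ≡ (x· e′) d k
x·-cong eq d zero    = refl
x·-cong eq d (suc k) = eq d k

y·-cong : ∀ {e e′} → (∀ d k → e d k ≡ e′ d k) → ∀ d k → (y· e) d k ≡ (y· e′) d k
y·-cong eq zero    k = refl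
y·-cong eq (suc d) k = eq d k

[x+y-1]·-cong : ∀ {e e′} → (∀ d k → e d k ≡ e′ d k) →
                ∀ d k → ([x+y-1]· e) d k ≡ ([x+y-1]· e′) d k
[x+y-1]·-cong eq d k =
  cong₂ ℤ._-_ (cong₂ ℤ._+_ (x·-cong eq d k) (y·-cong eq d k)) (eq d k)

[x+y-1]·-+ : ∀ e e′ d k → ([x+y-1]· λ d k → e d k ℤ.+ e′ d k) d k ≡
             ([x+y-1]· e) d k ℤ.+ ([x+y-1]· e′) d k
[x+y-1]·-+ e e′ zero    zero    = lemma (e 0 0) (e′ 0 0)
  where
  lemma : ∀ a b → ℤ.0ℤ ℤ.- (a ℤ.+ b) ≡ ℤ.0ℤ ℤ.- a ℤ.+ (ℤ.0ℤ ℤ.- b)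
  lemma = solve-∀
[x+y-1]·-+ e e′ zero    (suc k) = lemma (e 0 k) (e′ 0 k) (e 0 (suc k)) (e′ 0 (suc k))
  where
  lemma : ∀ a b c d → a ℤ.+ b ℤ.+ ℤ.0ℤ ℤ.- (c ℤ.+ d) ≡ a ℤ.+ ℤ.0ℤ ℤ.- c ℤ.+ (b ℤ.+ ℤ.0ℤ ℤ.- d)
  lemma = solve-∀
[x+y-1]·-+ e e′ (suc d) zero    = lemma (e d 0) (e′ d 0) (e (suc d) 0) (e′ (suc d) 0)
  where
  lemma : ∀ a b c d → ℤ.0ℤ ℤ.+ (a ℤ.+ b) ℤ.- (c ℤ.+ d) ≡ ℤ.0ℤ ℤ.+ a ℤ.- c ℤ.+ (ℤ.0ℤ ℤ.+ b ℤ.- d)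
  lemma = solve-∀
[x+y-1]·-+ e e′ (suc d) (suc k) =
  lemma (e (suc d) k) (e′ (suc d) k) (e d (suc k)) (e′ d (suc k)) (e (suc d) (suc k)) (e′ (suc d) (suc k))
  where
  lemma : ∀ a b c d f g → a ℤ.+ b ℤ.+ (c ℤ.+ d) ℤ.- (f ℤ.+ g) ≡
                          a ℤ.+ c ℤ.- f ℤ.+ (b ℤ.+ d ℤ.- g)
  lemma = solve-∀

monomial-+ : ∀ a b d k → monomial (a ℤ.+ b) d k ≡ monomial a d k ℤ.+ monomial b d k
monomial-+ a b zero    zero    = refl
monomial-+ a b zero    (suc k) = refl
monomial-+ a b (suc d) k       = refl

⟦⟨x+y-1⟩⟧ : ∀ c N d k → ⟦ applyUpTo c N ⟨ x+y-1 ⟩ ⟧ d k ≡ horner N c d k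
⟦⟨x+y-1⟩⟧ c zero    d k = refl
⟦⟨x+y-1⟩⟧ c (suc N) d k =
  trans (⟦⟧-+ (const ℤ[x] (const +-*-rawRing (c 0))) (mulPoly ℤ[x] x+y-1 q) d k)
    (cong₂ ℤ._+_ (⟦const⟧ (c 0) d k)
      (trans (⟦x+y-1*⟧ q d k) ([x+y-1]·-cong (⟦⟨x+y-1⟩⟧ (λ i → c (suc i)) N) d k)))
  where
  q = applyUpTo (λ i → c (suc i)) N ⟨ x+y-1 ⟩

horner-cong : ∀ N {c c′} → (∀ i → c i ≡ c′ i) → ∀ d k → horner N c d k ≡ horner N c′ d k
horner-cong zero    eq d k = refl
horner-cong (suc N) eq d k = cong₂ ℤ._+_
  (cong (λ a → monomial a d k) (eq 0))
  ([x+y-1]·-cong (horner-cong N (λ i → eq (suc i))) d k)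

horner-0 : ∀ N d k → horner N (λ _ → ℤ.0ℤ) d k ≡ ℤ.0ℤ
horner-0 zero    d k = refl
horner-0 (suc N) d k = trans
  (cong (λ a → monomial ℤ.0ℤ d k ℤ.+ a) ([x+y-1]·-cong (horner-0 N) d k)) (vanish d k)
  where
  vanish : ∀ d k → monomial ℤ.0ℤ d k ℤ.+ ([x+y-1]· λ _ _ → ℤ.0ℤ) d k ≡ ℤ.0ℤ
  vanish zero    zero    = refl
  vanish zero    (suc k) = refl
  vanish (suc d) zero    = refl
  vanish (suc d) (suc k) = refl

horner-+ : ∀ N c c′ d k → horner N (λ i → c i ℤ.+ c′ i) d k ≡ horner N c d k ℤ.+ horner N c′ d k
horner-+ zero    c c′ d k = refl
horner-+ (suc N) c c′ d k = trans
  (cong₂ ℤ._+_ (monomial-+ (c 0) (c′ 0) d k)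
    (trans ([x+y-1]·-cong (horner-+ N _ _) d k) ([x+y-1]·-+ _ _ d k)))
  (interchange (monomial (c 0) d k) (monomial (c′ 0) d k) _ _)
  where
  interchange : ∀ a b c d → a ℤ.+ b ℤ.+ (c ℤ.+ d) ≡ a ℤ.+ c ℤ.+ (b ℤ.+ d)
  interchange = solve-∀

-- Powers of x + y and the truncated binomial theorem

[x+y]^ : ℕ → Coefficients
[x+y]^ m d k = + (if m ≡ᵇ k ℕ.+ d then m C k else 0)

-- Away from the axes all three degree tests become the same boolean, and where it holds the claim
-- is Pascal's rule. On an axis only one shift contributes, and both binomials are 1.
[x+y]^-suc : ∀ m d k → [x+y]^ (suc m) d k ≡ (x· [x+y]^ m) d k ℤ.+ (y· [x+y]^ m) d k
[x+y]^-suc m zero    zero    = refl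
[x+y]^-suc m zero    (suc k) with m ≡ᵇ k ℕ.+ 0 in eq
... | false = refl
... | true with refl ← trans (ℕ.≡ᵇ⇒≡ m (k ℕ.+ 0) (subst T (sym eq) _)) (ℕ.+-identityʳ k) =
  cong +_ (trans (nCn≡1 (suc k)) (sym (trans (ℕ.+-identityʳ _) (nCn≡1 k))))
[x+y]^-suc m (suc d) zero    with m ≡ᵇ d
... | false = refl
... | true  = cong +_ (trans (nC0≡1 (suc m)) (sym (nC0≡1 m)))
[x+y]^-suc m (suc d) (suc k) rewrite ℕ.+-suc k d with m ≡ᵇ suc (k ℕ.+ d)
... | false = refl
... | true  = cong +_ (sym (nCk+nC[k+1]≡[n+1]C[k+1] m k))

-- Pascal's rule splits the coefficients after the leading one. The part `m C i` gives (x + y - 1)(x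
-- + y)^m; the part `m C suc i`, joined to the leading term, is the sum for `m` with one more
-- summand, namely (x + y)^m. Together they make (x + y)^(m+1). The bound `m < N` ensures that no
-- nonzero binomial is cut off.
horner-binomial : ∀ N m → m < N → ∀ d k → horner N (λ i → + (m C i)) d k ≡ [x+y]^ m d k
horner-binomial (suc N) zero m<N d k = trans
  (cong (λ a → monomial ℤ.1ℤ d k ℤ.+ a) ([x+y-1]·-cong (horner-0 N) d k)) (one d k)
  where
  one : ∀ d k → monomial ℤ.1ℤ d k ℤ.+ ([x+y-1]· λ _ _ → ℤ.0ℤ) d k ≡ [x+y]^ 0 d k
  one zero    zero    = refl
  one zero    (suc k) = refl
  one (suc d) zero    = refl
  one (suc d) (suc k) = refl
horner-binomial (suc N) (suc m) (s≤s m<N) d k = begin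
  monomial (+ (suc m C 0)) d k ℤ.+ ([x+y-1]· horner N (λ i → + (suc m C suc i))) d k
    ≡⟨ cong₂ ℤ._+_
         (cong (λ a → monomial (+ a) d k) (trans (nC0≡1 (suc m)) (sym (nC0≡1 m))))
         ([x+y-1]·-cong pascal d k) ⟩
  monomial (+ (m C 0)) d k ℤ.+ ([x+y-1]· λ d k → [x+y]^ m d k ℤ.+ horner N (λ i → + (m C suc i)) d k) d k
    ≡⟨ cong (λ a → monomial (+ (m C 0)) d k ℤ.+ a) ([x+y-1]·-+ _ _ d k) ⟩
  monomial (+ (m C 0)) d k ℤ.+ (([x+y-1]· [x+y]^ m) d k ℤ.+ ([x+y-1]· horner N (λ i → + (m C suc i))) d k)
    ≡⟨ swap (monomial (+ (m C 0)) d k) (([x+y-1]· [x+y]^ m) d k) _ ⟩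
  ([x+y-1]· [x+y]^ m) d k ℤ.+ horner (suc N) (λ i → + (m C i)) d k
    ≡⟨ cong (λ a → ([x+y-1]· [x+y]^ m) d k ℤ.+ a) (horner-binomial (suc N) m (ℕ.m≤n⇒m≤1+n m<N) d k) ⟩
  ([x+y-1]· [x+y]^ m) d k ℤ.+ [x+y]^ m d k
    ≡⟨ cancel _ ([x+y]^ m d k) ⟩
  (x· [x+y]^ m) d k ℤ.+ (y· [x+y]^ m) d k
    ≡⟨ [x+y]^-suc m d k ⟨
  [x+y]^ (suc m) d k ∎
  where
  open ≡-Reasoning
  pascal : ∀ d k → horner N (λ i → + (suc m C suc i)) d k ≡
                   [x+y]^ m d k ℤ.+ horner N (λ i → + (m C suc i)) d k
  pascal d k = trans
    (horner-cong N (λ i → cong +_ (sym (nCk+nC[k+1]≡[n+1]C[k+1] m i))) d k)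
    (trans (horner-+ N (λ i → + (m C i)) (λ i → + (m C suc i)) d k)
      (cong (ℤ._+ horner N (λ i → + (m C suc i)) d k) (horner-binomial N m m<N d k)))

  swap : ∀ a b c → a ℤ.+ (b ℤ.+ c) ≡ b ℤ.+ (a ℤ.+ c)
  swap = solve-∀

  cancel : ∀ a b → a ℤ.- b ℤ.+ b ≡ a
  cancel = solve-∀

[x+y]^-on : ∀ {m} d k → m ≡ k ℕ.+ d → [x+y]^ m d k ≡ + (m C k)
[x+y]^-on {m} d k eq = cong (λ b → + (if b then m C k else 0)) (dec-true (m ℕ.≟ k ℕ.+ d) eq)

[x+y]^-off : ∀ {m} d k → m ≢ k ℕ.+ d → [x+y]^ m d k ≡ ℤ.0ℤ
[x+y]^-off {m} d k neq = cong (λ b → + (if b then m C k else 0)) (dec-false (m ℕ.≟ k ℕ.+ d) neq)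

-- Truncation at the number of vertices

coefficient-upTo-< : ∀ (R : RawRing c ℓ) f {N i} → i < N → coefficient R (map f (upTo N)) i ≡ f i
coefficient-upTo-< R f {N} {i} i<N =
  trans (cong (λ p → coefficient R p i) (map-upTo f N)) (go f i<N)
  where
  go : ∀ f {N i} → i < N → coefficient R (applyUpTo f N) i ≡ f i
  go f {suc N} {zero}  (s≤s i<N) = refl
  go f {suc N} {suc i} (s≤s i<N) = go (f ∘ suc) i<N

coefficient-upTo-≥ : ∀ (R : RawRing c ℓ) f {N i} → N ≤ i →
                     coefficient R (map f (upTo N)) i ≡ RawRing.0# R
coefficient-upTo-≥ R f {N} {i} N≤i =
  trans (cong (λ p → coefficient R p i) (map-upTo f N)) (go f N≤i)
  where
  go : ∀ f {N i} → N ≤ i → coefficient R (applyUpTo f N) i ≡ RawRing.0# R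
  go f {zero}          N≤i       = refl
  go f {suc N} {suc i} (s≤s N≤i) = go (f ∘ suc) N≤i

⟦map-upTo⟧ : ∀ (e : Coefficients) N →
             (∀ d k → N ≤ d → e d k ≡ ℤ.0ℤ) → (∀ d k → N ≤ k → e d k ≡ ℤ.0ℤ) →
             ∀ d k → ⟦ map (λ d → map (e d) (upTo N)) (upTo N) ⟧ d k ≡ e d k
⟦map-upTo⟧ e N high-d high-k d k with d ℕ.<? N
... | no d≮N = trans
  (cong (λ p → coefficient +-*-rawRing p k) (coefficient-upTo-≥ ℤ[x] _ (ℕ.≮⇒≥ d≮N)))
  (sym (high-d d k (ℕ.≮⇒≥ d≮N)))
... | yes d<N = trans
  (cong (λ p → coefficient +-*-rawRing p k) (coefficient-upTo-< ℤ[x] _ d<N)) row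
  where
  row : coefficient +-*-rawRing (map (e d) (upTo N)) k ≡ e d k
  row with k ℕ.<? N
  ... | yes k<N = coefficient-upTo-< +-*-rawRing (e d) k<N
  ... | no  k≮N = trans (coefficient-upTo-≥ +-*-rawRing (e d) (ℕ.≮⇒≥ k≮N))
                        (sym (high-k d k (ℕ.≮⇒≥ k≮N)))

-- A single vanishing bound on `k ℕ.+ d` covers the cut-off in either degree.
distanceCubePolynomial≈ : (G : Graph) (u : Graph.Vertex G) →
  let open RawRing ℤ[x,y]; N = Graph.size G in
  (∀ d k → N ≤ k ℕ.+ d → + cubeCountAt G u k d ≡ ℤ.0ℤ) →
  (∀ d k → + cubeCountAt G u k d ≡ horner N (λ i → + cubeCount G i) d k) →
  distanceCubePolynomial G u ≈ cubePolynomial G ⟨ x + y + (- 1#) ⟩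
distanceCubePolynomial≈ G u high counts d k = begin
  ⟦ distanceCubePolynomial G u ⟧ d k
    ≡⟨ ⟦map-upTo⟧ (λ d k → + cubeCountAt G u k d) N
         (λ d k N≤d → high d k (ℕ.m≤n⇒m≤o+n k N≤d))
         (λ d k N≤k → high d k (ℕ.m≤n⇒m≤n+o d N≤k)) d k ⟩
  + cubeCountAt G u k d
    ≡⟨ counts d k ⟩
  horner N (λ i → + cubeCount G i) d k
    ≡⟨ ⟦⟨x+y-1⟩⟧ (λ i → + cubeCount G i) N d k ⟨
  ⟦ applyUpTo (λ i → + cubeCount G i) N ⟨ x+y-1 ⟩ ⟧ d k
    ≡⟨ cong (λ p → ⟦ p ⟨ x+y-1 ⟩ ⟧ d k) (map-upTo (λ i → + cubeCount G i) N) ⟨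
  ⟦ cubePolynomial G ⟨ x+y-1 ⟩ ⟧ d k ∎
  where
  open ≡-Reasoning
  N = Graph.size G

-- Daisy cubes

isMinimum-unique : {P : Pred ℕ ℓ} {d e : ℕ} → IsMinimum P d → IsMinimum P e → d ≡ e
isMinimum-unique (p , d≤) (q , e≤) = ℕ.≤-antisym (d≤ _ q) (e≤ _ p)

n<2^n : ∀ n → n < 2 ^ n
n<2^n zero    = s≤s z≤n
n<2^n (suc n) = begin
  suc (suc n)      ≤⟨ s≤s (n<2^n n) ⟩
  suc (2 ^ n)      ≤⟨ ℕ.+-mono-≤ (ℕ.m^n>0 2 n) (ℕ.m≤m+n (2 ^ n) 0) ⟩
  2 ^ suc n        ∎
  where open ℕ.≤-Reasoning

downset : (v : Word n) → Face n ∣ v ∣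
downset []          = []
downset (false ∷ v) = fixed false (downset v)
downset (true ∷ v)  = free (downset v)

top-downset : (v : Word n) → top (downset v) ≡ v
top-downset []          = refl
top-downset (false ∷ v) = cong (false ∷_) (top-downset v)
top-downset (true ∷ v)  = cong (true ∷_) (top-downset v)

module _ {n} {X : Pred (Word n) ℓ} (X? : Decidable X) where

  private
    G = daisyCube X?
    open module G = Graph G using (index; element; index-element; element-index)

  below-≤ : {u v : Word n} → u ≤ʷ v → Below X? v → Below X? u
  below-≤ u≤v (x , x∈X , v≤x) = x , x∈X , ≤ʷ-trans u≤v v≤x

  below-vertex : (v : G.Vertex) → Below X? (proj₁ v)
  below-vertex (v , v∈G) = toWitness v∈G

  vertex : (v : Word n) → Below X? v → G.Vertex
  vertex v v∈G = v , fromWitness v∈G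

  proj₁-injective : {u v : G.Vertex} → proj₁ u ≡ proj₁ v → u ≡ v
  proj₁-injective = Σ-T-≡

  -- Distances from the origin

  walk⇒∣∣≤ : ∀ l {u v : G.Vertex} → Walk G u v l → ∣ proj₁ v ∣ ≤ l ℕ.+ ∣ proj₁ u ∣
  walk⇒∣∣≤ zero    refl               = ℕ.≤-refl
  walk⇒∣∣≤ (suc l) {u} {v} (w , u~w , walk) = begin
    ∣ proj₁ v ∣            ≤⟨ walk⇒∣∣≤ l walk ⟩
    l ℕ.+ ∣ proj₁ w ∣      ≤⟨ ℕ.+-monoʳ-≤ l (∣∣-adjacent u-w) ⟩
    l ℕ.+ suc ∣ proj₁ u ∣  ≡⟨ ℕ.+-suc l _ ⟩
    suc l ℕ.+ ∣ proj₁ u ∣  ∎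
    where
    open ℕ.≤-Reasoning
    u-w = differInOne⇒adjacent (proj₁ u) (proj₁ w) u~w

  -- Every word on an increasing path lies below its end `v`, so the path never leaves the daisy
  -- cube.
  ascend : ∀ l {u v : G.Vertex} → proj₁ u ≤ʷ proj₁ v →
           ∣ proj₁ v ∣ ≡ l ℕ.+ ∣ proj₁ u ∣ → Walk G u v l
  ascend zero    u≤v eq = proj₁-injective (≤ʷ∧∣∣≡⇒≡ u≤v eq)
  ascend (suc l) {u} {v} u≤v eq
    with w , adj , w≤v , eq′ ← step-up l u≤v eq
    = vertex w (below-≤ w≤v (below-vertex v)) , adjacent⇒differInOne adj , ascend l w≤v eq′

  distance-origin : (s : Satisfiable X) (v : G.Vertex) →
                    Distance G (daisyOrigin X? s) v ∣ proj₁ v ∣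
  distance-origin s v =
    ascend _ (0ʷ≤ (proj₁ v)) (sym (+∣0ʷ∣ _)) ,
    λ l walk → ℕ.≤-trans (walk⇒∣∣≤ l walk) (ℕ.≤-reflexive (+∣0ʷ∣ l))
    where
    +∣0ʷ∣ : ∀ l → l ℕ.+ ∣ 0ʷ {n} ∣ ≡ l
    +∣0ʷ∣ l = trans (cong (l ℕ.+_) (∣0ʷ∣≡0 n)) (ℕ.+-identityʳ l)

  -- Only the trace of the face on the daisy cube; it is the whole face precisely when the top is a
  -- vertex, hence the recurring hypothesis `Below X? (top F)`.
  vertexSet : Face n k → VertexSet G
  vertexSet F = Vec.tabulate (λ i → does (proj₁ (element i) ∈ᶠ? F))

  lookup-vertexSet : (F : Face n k) (v : G.Vertex) →
                     lookup (vertexSet F) (index v) ≡ does (proj₁ v ∈ᶠ? F)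
  lookup-vertexSet F v = trans
    (lookup∘tabulate _ (index v)) (cong (λ u → does (proj₁ u ∈ᶠ? F)) (element-index v))

  ∈-vertexSet⁺ : (F : Face n k) (v : G.Vertex) → proj₁ v ∈ᶠ F → index v ∈ˢ vertexSet F
  ∈-vertexSet⁺ F v v∈F = lookup⇒[]= (index v) _
    (trans (lookup-vertexSet F v) (dec-true (proj₁ v ∈ᶠ? F) v∈F))

  ∈-vertexSet⁻ : (F : Face n k) (v : G.Vertex) → index v ∈ˢ vertexSet F → proj₁ v ∈ᶠ F
  ∈-vertexSet⁻ F v v∈S with proj₁ v ∈ᶠ? F | trans (sym (lookup-vertexSet F v)) ([]=⇒lookup v∈S)
  ... | yes v∈F | _  = v∈F
  ... | no  _   | ()

  vertexSet-injective : {F F′ : Face n k} → Below X? (top F) → Below X? (top F′) →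
                        vertexSet F ≡ vertexSet F′ → F ≡ F′
  vertexSet-injective {F = F} {F′} F⊆G F′⊆G eq = face-extensional F F′ λ v → mk⇔
    (transport F F′ F⊆G eq) (transport F′ F F′⊆G (sym eq))
    where
    transport : ∀ F F′ → Below X? (top F) → vertexSet F ≡ vertexSet F′ →
                ∀ {v} → v ∈ᶠ F → v ∈ᶠ F′
    transport F F′ F⊆G eq {v} v∈F = ∈-vertexSet⁻ F′ v′
      (subst (index v′ ∈ˢ_) eq (∈-vertexSet⁺ F v′ v∈F))
      where v′ = vertex v (below-≤ (≤top v∈F) F⊆G)

  subset-extensional : {S S′ : VertexSet G} →
    (∀ v → index v ∈ˢ S → index v ∈ˢ S′) → (∀ v → index v ∈ˢ S′ → index v ∈ˢ S) → S ≡ S′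
  subset-extensional S⊆S′ S′⊆S = ⊆-antisym (lift S⊆S′) (lift S′⊆S)
    where
    lift : {S S′ : VertexSet G} → (∀ v → index v ∈ˢ S → index v ∈ˢ S′) → S ⊆ S′
    lift {S} {S′} S⊆S′ {i} i∈S = subst (_∈ˢ S′) (index-element i)
      (S⊆S′ (element i) (subst (_∈ˢ S) (sym (index-element i)) i∈S))

  -- The bottom is the least word of the face and weight is monotone, so no other vertex of the face
  -- is nearer to the origin.
  distance-face : (s : Satisfiable X) (F : Face n k) → Below X? (top F) →
                  DistanceToSet G (daisyOrigin X? s) (vertexSet F) ∣ bottom F ∣
  distance-face s F F⊆G =
    (b , ∈-vertexSet⁺ F b (bottom∈ F) , distance-origin s b) ,
    λ { e (v , v∈S , dist) → begin
      ∣ bottom F ∣   ≤⟨ ∣∣-mono (bottom≤ (∈-vertexSet⁻ F v v∈S)) ⟩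
      ∣ proj₁ v ∣    ≡⟨ isMinimum-unique (distance-origin s v) dist ⟩
      e              ∎ }
    where
    open ℕ.≤-Reasoning
    b = vertex (bottom F) (below-≤ (≤top (bottom∈ F)) F⊆G)

  -- Induced cubes are the faces with top in the daisy cube

  face⇒cube : (F : Face n k) → Below X? (top F) → inducedOn G (vertexSet F) ≅ Q k
  face⇒cube {k} F F⊆G = record
    { bijection = mk↔ₛ′ to from
        (λ w → coordinates-point F w)
        (λ v → Σ-T-≡ (proj₁-injective (point-coordinates (v∈F v))))
    ; adjacency = λ u v → mk⇔
        (λ u~v → adjacent⇒differInOne
          (coordinates-adjacent (v∈F u) (v∈F v) (differInOne⇒adjacent _ _ u~v)))
        (λ tu~tv → subst₂ DifferInOne (point-coordinates (v∈F u)) (point-coordinates (v∈F v))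
          (adjacent⇒differInOne (point-adjacent F (differInOne⇒adjacent _ _ tu~tv))))
    }
    where
    H = inducedOn G (vertexSet F)

    v∈F : (v : Graph.Vertex H) → proj₁ (proj₁ v) ∈ᶠ F
    v∈F (v , v∈S) = ∈-vertexSet⁻ F v (toWitness v∈S)

    to : Graph.Vertex H → Word k
    to (v , _) = coordinates F (proj₁ v)

    from : Word k → Graph.Vertex H
    from w = v , fromWitness (∈-vertexSet⁺ F v (point∈ F w))
      where v = vertex (point F w) (below-≤ (≤top (point∈ F w)) F⊆G)

  -- The inverse isomorphism, read as a map between words, satisfies the hypotheses of `cube-image`.
  -- The top of the resulting face is one of its values, hence a vertex of the daisy cube.
  cube⇒face : {S : VertexSet G} → inducedOn G S ≅ Q k →
              ∃ λ (F : Face n k) → Below X? (top F) × vertexSet F ≡ S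
  cube⇒face {k} {S} iso = F , F⊆G , subset-extensional set⊆S S⊆set
    where
    open _≅_ iso

    f : Word k → Word n
    f w = proj₁ (proj₁ (from w))

    f-injective : Injective _≡_ _≡_ f
    f-injective = Injection.injective (↔⇒↣ (↔-sym bijection)) ∘ Σ-T-≡ ∘ proj₁-injective

    f-adjacent : ∀ {w w′} → Adjacent w w′ → Adjacent (f w) (f w′)
    f-adjacent adj = differInOne⇒adjacent _ _ (Equivalence.from (adjacency _ _)
      (subst₂ DifferInOne (sym (Inverse.strictlyInverseˡ bijection _))
        (sym (Inverse.strictlyInverseˡ bijection _)) (adjacent⇒differInOne adj)))

    image : ∃ λ (F : Face n k) → ∀ v → v ∈ᶠ F ⇔ ∃ λ w → f w ≡ v
    image = cube-image f f-injective f-adjacent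

    F : Face n k
    F = proj₁ image

    F⇔ : ∀ v → v ∈ᶠ F ⇔ ∃ λ w → f w ≡ v
    F⇔ = proj₂ image

    F⊆G : Below X? (top F)
    F⊆G with w , eq ← Equivalence.to (F⇔ _) (top∈ F) =
      subst (Below X?) eq (below-vertex (proj₁ (from w)))

    set⊆S : ∀ v → index v ∈ˢ vertexSet F → index v ∈ˢ S
    set⊆S v v∈ with w , eq ← Equivalence.to (F⇔ _) (∈-vertexSet⁻ F v v∈) =
      subst (λ u → index u ∈ˢ S) (proj₁-injective eq) (toWitness (proj₂ (from w)))

    S⊆set : ∀ v → index v ∈ˢ S → index v ∈ˢ vertexSet F
    S⊆set v v∈S = ∈-vertexSet⁺ F v (Equivalence.from (F⇔ _)
      (to u , cong (proj₁ ∘ proj₁) (Inverse.strictlyInverseʳ bijection u)))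
      where u = v , fromWitness v∈S

  -- The interval from `0ʷ` to `v` lies in the daisy cube and has 2^m > m words, m being the weight
  -- of `v`. Hence the cut-off exceeds every weight.
  ∣∣<size : (v : G.Vertex) → ∣ proj₁ v ∣ < G.size
  ∣∣<size v = ℕ.<-≤-trans (n<2^n m) (Fin.injective⇒≤ {f = f} f-injective)
    where
    m = ∣ proj₁ v ∣
    F = downset (proj₁ v)
    module Words = Finite (Vec-Bool-finite m)

    g : Word m → G.Vertex
    g w = vertex (point F w) (below-≤ (subst (point F w ≤ʷ_) (top-downset _) (≤top (point∈ F w)))
                                      (below-vertex v))

    f : Fin (2 ^ m) → Fin G.size
    f = index ∘ g ∘ Words.element

    f-injective : Injective _≡_ _≡_ f
    f-injective =
      Injection.injective (↔⇒↣ (↔-sym Words.enum)) ∘ g-injective ∘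
      Injection.injective (↔⇒↣ G.enum)
      where
      g-injective : Injective _≡_ _≡_ g
      g-injective {w} {w′} eq = trans (sym (coordinates-point F w))
        (trans (cong (coordinates F ∘ proj₁) eq) (coordinates-point F w′))

  -- Counting cubes by their tops

  -- The list of tops is a parameter so that one construction serves both counts: all vertices for
  -- `cubeCount`, those of weight `k ℕ.+ d` for `cubeCountAt`.
  cubes : List G.Vertex → (k : ℕ) → List (VertexSet G)
  cubes tops k = map vertexSet (concatMap (λ t → faces (proj₁ t) k) tops)

  atHeight? : ∀ h → Decidable (λ (v : G.Vertex) → ∣ proj₁ v ∣ ≡ h)
  atHeight? h v = ∣ proj₁ v ∣ ℕ.≟ h

  ∈-cubes⁺ : {tops : List G.Vertex} {F : Face n k} {t : G.Vertex} →
             t ∈ tops → top F ≡ proj₁ t → vertexSet F ∈ cubes tops k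
  ∈-cubes⁺ {F = F} t∈tops eq = ∈-map⁺ vertexSet (∈-concatMap⁺ _
    (lose t∈tops (subst (λ t → F ∈ faces t _) eq (∈-faces⁺ F))))

  ∈-cubes⁻ : (tops : List G.Vertex) {S : VertexSet G} → S ∈ cubes tops k →
             ∃ λ (F : Face n k) → ∃ λ t → t ∈ tops × top F ≡ proj₁ t × S ≡ vertexSet F
  ∈-cubes⁻ tops S∈ =
    let F , F∈ , eq = ∈-map⁻ vertexSet S∈
        t , t∈tops , F∈ = find (∈-concatMap⁻ _ {tops} F∈)
    in F , t , t∈tops , ∈-faces⁻ (proj₁ t) F∈ , eq

  -- A face determines its top, so the lists for distinct tops are disjoint; each top is a vertex,
  -- so `vertexSet` is injective on these faces.
  cubes-unique : {tops : List G.Vertex} → Unique tops → Unique (cubes tops k)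
  cubes-unique {k = k} {tops} tops! = map-unique
    (λ F∈ F′∈ → vertexSet-injective (top∈G F∈) (top∈G F′∈))
    (concatMap-unique (λ t → faces-unique (proj₁ t) k)
      (λ {t} {t′} F∈ F∈′ → proj₁-injective
        (trans (sym (∈-faces⁻ (proj₁ t) F∈)) (∈-faces⁻ (proj₁ t′) F∈′)))
      tops!)
    where
    top∈G : ∀ {F} → F ∈ concatMap (λ t → faces (proj₁ t) k) tops → Below X? (top F)
    top∈G F∈ =
      let t , _ , F∈ = find (∈-concatMap⁻ _ {tops} F∈)
      in subst (Below X?) (sym (∈-faces⁻ (proj₁ t) F∈)) (below-vertex t)

  cubeCount≡ : ∀ k → cubeCount G k ≡ length (cubes G.elements k)
  cubeCount≡ k = cubeCount≡length G (cubes-unique (elements-unique G.finite)) k sound complete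
    where
    sound : ∀ {S} → S ∈ cubes G.elements k → inducedOn G S ≅ Q k
    sound S∈ =
      let F , t , _ , eq , S≡ = ∈-cubes⁻ G.elements S∈
      in subst (λ S → inducedOn G S ≅ Q k) (sym S≡)
           (face⇒cube F (subst (Below X?) (sym eq) (below-vertex t)))

    complete : ∀ {S} → inducedOn G S ≅ Q k → S ∈ cubes G.elements k
    complete iso =
      let F , F⊆G , ≡S = cube⇒face iso
      in subst (_∈ cubes G.elements k) ≡S
           (∈-cubes⁺ (∈-elements G.finite (vertex (top F) F⊆G)) refl)

  -- By `∣top∣`, the bottom of a `k`-face has weight `d` exactly when its top has weight `k ℕ.+ d`.
  cubeCountAt≡ : (s : Satisfiable X) (k d : ℕ) → cubeCountAt G (daisyOrigin X? s) k d ≡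
                 length (cubes (filter (atHeight? (k ℕ.+ d)) G.elements) k)
  cubeCountAt≡ s k d = cubeCountAt≡length G
    (cubes-unique (Unique.filter⁺ (atHeight? (k ℕ.+ d)) (elements-unique G.finite)))
    0ⁿ k d sound complete
    where
    0ⁿ = daisyOrigin X? s
    tops = filter (atHeight? (k ℕ.+ d)) G.elements

    sound : ∀ {S} → S ∈ cubes tops k → inducedOn G S ≅ Q k × DistanceToSet G 0ⁿ S d
    sound S∈ =
      let F , t , t∈ , eq , S≡ = ∈-cubes⁻ tops S∈
          F⊆G = subst (Below X?) (sym eq) (below-vertex t)
          height = ℕ.+-cancelˡ-≡ k _ _ (trans (sym (∣top∣ F)) (trans (cong ∣_∣ eq)
            (proj₂ (∈-filter⁻ (atHeight? (k ℕ.+ d)) {xs = G.elements} t∈))))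
      in subst (λ S → inducedOn G S ≅ Q k × DistanceToSet G 0ⁿ S d) (sym S≡)
           (face⇒cube F F⊆G ,
            subst (DistanceToSet G 0ⁿ (vertexSet F)) height (distance-face s F F⊆G))

    complete : ∀ {S} → inducedOn G S ≅ Q k × DistanceToSet G 0ⁿ S d → S ∈ cubes tops k
    complete (iso , dist) =
      let F , F⊆G , ≡S = cube⇒face iso
          dist-F = subst (λ S → DistanceToSet G 0ⁿ S d) (sym ≡S) dist
      in subst (_∈ cubes tops k) ≡S (∈-cubes⁺
           (∈-filter⁺ (atHeight? (k ℕ.+ d)) (∈-elements G.finite (vertex (top F) F⊆G))
             (trans (∣top∣ F) (cong (k ℕ.+_) (isMinimum-unique (distance-face s F F⊆G) dist-F))))
           refl)

  length-cubes-∷ : ∀ t tops k →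
                   length (cubes (t ∷ tops) k) ≡ ∣ proj₁ t ∣ C k ℕ.+ length (cubes tops k)
  length-cubes-∷ t tops k = begin
    length (cubes (t ∷ tops) k)
      ≡⟨ length-map _ (faces (proj₁ t) k ++ rest) ⟩
    length (faces (proj₁ t) k ++ rest)
      ≡⟨ length-++ (faces (proj₁ t) k) ⟩
    length (faces (proj₁ t) k) ℕ.+ length rest
      ≡⟨ cong₂ ℕ._+_ (length-faces (proj₁ t) k) (sym (length-map _ rest)) ⟩
    ∣ proj₁ t ∣ C k ℕ.+ length (cubes tops k) ∎
    where
    open ≡-Reasoning
    rest = concatMap (λ t → faces (proj₁ t) k) tops

  -- The filter keeps `t` exactly for the degrees in which the homogeneous polynomial (x + y)^m, m
  -- the weight of `t`, may have a nonzero coefficient.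
  length-cubes-filter : ∀ t tops d k →
    + length (cubes (filter (atHeight? (k ℕ.+ d)) (t ∷ tops)) k) ≡
    [x+y]^ ∣ proj₁ t ∣ d k ℤ.+ + length (cubes (filter (atHeight? (k ℕ.+ d)) tops) k)
  length-cubes-filter t tops d k = by-height (atHeight? (k ℕ.+ d) t)
    where
    open ≡-Reasoning
    rest = filter (atHeight? (k ℕ.+ d)) tops

    by-height : Dec (∣ proj₁ t ∣ ≡ k ℕ.+ d) →
      + length (cubes (filter (atHeight? (k ℕ.+ d)) (t ∷ tops)) k) ≡
      [x+y]^ ∣ proj₁ t ∣ d k ℤ.+ + length (cubes rest k)
    by-height (yes eq) = begin
      + length (cubes (filter (atHeight? (k ℕ.+ d)) (t ∷ tops)) k)
        ≡⟨ cong (λ ts → + length (cubes ts k)) (filter-accept (atHeight? (k ℕ.+ d)) {t} {tops} eq) ⟩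
      + length (cubes (t ∷ rest) k)
        ≡⟨ cong +_ (length-cubes-∷ t rest k) ⟩
      + (∣ proj₁ t ∣ C k) ℤ.+ + length (cubes rest k)
        ≡⟨ cong (ℤ._+ + length (cubes rest k)) ([x+y]^-on d k eq) ⟨
      [x+y]^ ∣ proj₁ t ∣ d k ℤ.+ + length (cubes rest k) ∎
    by-height (no neq) = begin
      + length (cubes (filter (atHeight? (k ℕ.+ d)) (t ∷ tops)) k)
        ≡⟨ cong (λ ts → + length (cubes ts k)) (filter-reject (atHeight? (k ℕ.+ d)) {t} {tops} neq) ⟩
      -- The zero appears by computation and stands for the vanishing coefficient of the rejected
      -- top.
      ℤ.0ℤ ℤ.+ + length (cubes rest k)
        ≡⟨ cong (ℤ._+ + length (cubes rest k)) ([x+y]^-off d k neq) ⟨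
      [x+y]^ ∣ proj₁ t ∣ d k ℤ.+ + length (cubes rest k) ∎

  -- Both sides are additive in the list of tops, the left one because `horner` is linear; a single
  -- top is the case settled by `horner-binomial`.
  horner-cubes : ∀ N → (∀ t → ∣ proj₁ t ∣ < N) → ∀ tops d k →
    horner N (λ i → + length (cubes tops i)) d k ≡
    + length (cubes (filter (atHeight? (k ℕ.+ d)) tops) k)
  horner-cubes N <N []         d k = horner-0 N d k
  horner-cubes N <N (t ∷ tops) d k = begin
    horner N (λ i → + length (cubes (t ∷ tops) i)) d k
      ≡⟨ horner-cong N (λ i → cong +_ (length-cubes-∷ t tops i)) d k ⟩
    horner N (λ i → + (∣ proj₁ t ∣ C i) ℤ.+ + length (cubes tops i)) d k
      ≡⟨ horner-+ N (λ i → + (∣ proj₁ t ∣ C i)) (λ i → + length (cubes tops i)) d k ⟩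
    horner N (λ i → + (∣ proj₁ t ∣ C i)) d k ℤ.+ horner N (λ i → + length (cubes tops i)) d k
      ≡⟨ cong₂ ℤ._+_ (horner-binomial N ∣ proj₁ t ∣ (<N t) d k) (horner-cubes N <N tops d k) ⟩
    [x+y]^ ∣ proj₁ t ∣ d k ℤ.+ + length (cubes (filter (atHeight? (k ℕ.+ d)) tops) k)
      ≡⟨ length-cubes-filter t tops d k ⟨
    + length (cubes (filter (atHeight? (k ℕ.+ d)) (t ∷ tops)) k) ∎
    where open ≡-Reasoning

  cubeCountAt-high : (s : Satisfiable X) → ∀ d k → G.size ≤ k ℕ.+ d →
                     + cubeCountAt G (daisyOrigin X? s) k d ≡ ℤ.0ℤ
  cubeCountAt-high s d k size≤ = cong +_ (trans (cubeCountAt≡ s k d)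
    (cong (λ tops → length (cubes tops k)) (filter-none (atHeight? (k ℕ.+ d)) {G.elements}
      (All.tabulate λ {t} _ → ℕ.<⇒≢ (ℕ.<-≤-trans (∣∣<size t) size≤)))))

  cubeCountAt≡horner : (s : Satisfiable X) → ∀ d k →
    + cubeCountAt G (daisyOrigin X? s) k d ≡ horner G.size (λ i → + cubeCount G i) d k
  cubeCountAt≡horner s d k = trans (cong +_ (cubeCountAt≡ s k d)) (sym (trans
    (horner-cong G.size (λ i → cong +_ (cubeCount≡ i)) d k)
    (horner-cubes G.size ∣∣<size G.elements d k)))

theorem3p3 : ∀ {ℓ : Level} (n : ℕ) (X : Pred (Word n) ℓ) (X? : Decidable X) (nonempty : Satisfiable X) →
    let open RawRing ℤ[x,y]
        G = daisyCube X?
        0ⁿ = daisyOrigin X? nonempty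
    in distanceCubePolynomial G 0ⁿ ≈ cubePolynomial G ⟨ x + y + (- 1#) ⟩
theorem3p3 n X X? nonempty =
  distanceCubePolynomial≈ (daisyCube {X = X} X?) (daisyOrigin {X = X} X? nonempty)
    (cubeCountAt-high {X = X} X? nonempty) (cubeCountAt≡horner {X = X} X? nonempty)
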